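{- Let $\mathcal C$ be a cartesian left $R$-additive category, where $R$ has multiplicative inverses for integers, and assume that the additive structure of $\mathcal C$ is cancellative: for parallel morphisms, $f+g=f+h$ implies $g=h$. Let $n\in\mathbb N\cup\{\omega\}$ with $n\ge1$ (if $n=\omega$, assume countable powers exist in $\mathcal C$). Then there is a bijection between derivatives $D$ on $\mathcal C$ and order $n$ Taylor expansions $U$ on $\mathcal C$, given by the mutually inverse maps $\phi:U\mapsto u_1$ and $\psi:D\mapsto T_n$, where $u_1f=\pi_1\circ Uf\circ z_{1\to n}$ and $T_n$ is the order $n$ Taylor expansion functor induced by $D$.
   Context: $R$ is a commutative semiring with multiplicative inverses for integers: for each integer $n\ge1$ there is $\frac1n\in R$ with $\frac1n\cdot(1_R+\cdots+1_R)=1_R$ ($n$ summands). A map between $R$-semimodules is $R$-additive if it preserves sums, $0$ and the action of $R$. A left $R$-additive category is a category $\mathcal C$ whose hom-sets are $R$-semimodules and such that every precomposition map $\_\circ f$ is $R$-additive; a morphism $h:Y\to Z$ is $R$-additive if every postcomposition map $h\circ\_:\mathcal C(X,Y)\to\mathcal C(X,Z)$ is $R$-additive. A cartesian left $R$-additive category is one with finite products whose projections are $R$-additive. $\langle\cdots\rangle$ denotes tupling. Put $SX=X\times X$ with projections $\pi_0,\pi_1:SX\to X$. A derivative (differential) is a family of operators $D:\mathcal C(X,Y)\to\mathcal C(SX,Y)$ such that: (i) $Dp=p\circ\pi_1$ for every product projection $p:X_0\times\cdots\times X_n\to X_i$; (ii) $D$ is $R$-additive; (iii) $D\,\mathrm{id}=\pi_1$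 and $D(g\circ f)=Dg\circ\langle f\circ\pi_0,Df\rangle$; (iv) $Df$ is $R$-additive in its second argument, i.e. $u\mapsto Df\circ\langle x,u\rangle$ is $R$-additive; (v) $DDf\circ\langle\langle x,0\rangle,\langle 0,u\rangle\rangle=Df\circ\langle x,u\rangle$; (vi) $DDf\circ\langle\langle x,u\rangle,\langle v,w\rangle\rangle=DDf\circ\langle\langle x,v\rangle,\langle u,w\rangle\rangle$. For $n\in\mathbb N$, $S_nX=X^{n+1}$ with projections $\pi_0,\dots,\pi_n$; $S_\omega X=\prod_{i=0}^\infty X$ with projections $\pi_i$, $i\in\mathbb N$; $S_nf$ is the corresponding power of $f$. When $n=\omega$, the projections of countable powers are also required to be $R$-additive, and the conditions on projections ((i) above and (1) below) are understood to include them. For finite $m\le n$: $s_{n\to m}=\langle\pi_0,\dots,\pi_m\rangle:S_nX\to S_mX$, and $z_{m\to n}:S_mX\to S_nX$ is given by $\pi_k\circ z_{m\to n}=\pi_k$ if $k\le m$ and $0$ otherwise. The families $\iota_n:X\to S_nX$, $\theta_n:S_nS_nX\to S_nX$, $c_{n,n}:S_nS_nX\to S_nS_nX$, $l_n:S_nX\to S_nS_nX$, $m_n(r):S_nX\to S_nX$ ($r\in R$) are given by $\pi_k\circ\iota_n=\mathrm{id}$ if $k=0$, else $0$; $\pi_k\circ\theta_n=\sum_{i+j=k}\pi_i\circ\pi_j$; $\pi_i\circ\pi_j\circ c_{n,n}=\pi_j\circ\pi_i$; $\pi_i\circ\pi_j\circ l_n=\pi_i$ if $i=j$, else $0$; $\pi_k\circ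 m_n(r)=r^k\pi_k$. An order $n$ Taylor expansion in $\mathcal C$ is a functor $U:\mathcal C\to\mathcal C$ with $UX=S_nX$ such that: (1) $Up=S_np$ for every product projection $p$, $U(\pi_0+\pi_1)=S_n(\pi_0+\pi_1)$ for $\pi_0+\pi_1:X\times X\to X$, and $U(r\cdot\mathrm{id}_X)=S_n(r\cdot\mathrm{id}_X)$ for all $r\in R$; (2) $\pi_0:U\Rightarrow\mathrm{Id}$, $\iota_n:\mathrm{Id}\Rightarrow U$, $\theta_n:UU\Rightarrow U$, $m_n(r):U\Rightarrow U$ (all $r$), $c_{n,n}:UU\Rightarrow UU$ and $l_n:U\Rightarrow UU$ are natural in $\mathcal C$. Given a derivative $D$: for $1\le k<\omega$ let $\nu_k=\langle\langle\pi_0,\dots,\pi_{k-1}\rangle,\langle\tfrac1k\pi_1,\tfrac2k\pi_2,\dots,\tfrac kk\pi_k\rangle\rangle:S_kX\to SS_{k-1}X$; for $f:X\to Y$ let $t_0f=f$, $t_{k+1}f=D(t_kf)\circ\nu_{k+1}:S_{k+1}X\to Y$; then $T_nX=S_nX$ and $\pi_i\circ T_nf=t_if\circ s_{n\to i}$ for all finite $i\le n$. -}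

module Defs where

open import Algebra.Bundles using (CommutativeSemiring)
import Algebra.Definitions as AlgebraDefinitions
import Algebra.Definitions.RawMonoid as RawMonoidDefinitions
import Algebra.Definitions.RawSemiring as RawSemiringDefinitions
open import Algebra.Module.Bundles using (LeftSemimodule)
open import Algebra.Module.Morphism.Structures using (module LeftSemimoduleMorphisms)
open import Algebra.Module.Structures using (IsLeftSemimodule)
open import Data.Bool.Base using (if_then_else_)
open import Data.Fin.Base using (Fin; zero; suc; toℕ; fromℕ<; inject₁; inject≤; opposite)
open import Data.Fin.Properties using (toℕ≤pred[n])
open import Data.Nat.Base as ℕ using (ℕ; zero; suc; s≤s; NonZero)
import Data.Nat.Properties as ℕ
open import Data.Unit.Base using (⊤; tt)
open import Data.Vec.Functional using ([]; _∷_)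
open import Function.Base using () renaming (id to idᶠ; _∘_ to _∘ᶠ_)
open import Level using (_⊔_) renaming (suc to lsuc)
open import Relation.Binary.Bundles using (Setoid)
open import Relation.Binary.Core using (Rel)
open import Relation.Binary.Structures using (IsEquivalence)
open import Relation.Nullary.Decidable.Core using (Dec; yes; no; does)

record IntegerInverses {c ℓr} (R : CommutativeSemiring c ℓr) : Set (c ⊔ ℓr) where
  open CommutativeSemiring R
  open RawMonoidDefinitions +-rawMonoid using (_×_)

  field
    1/_      : (n : ℕ) → .{{NonZero n}} → Carrier
    inverseˡ : (n : ℕ) .{{_ : NonZero n}} → (1/ n) * (n × 1#) ≈ 1#

  frac : ℕ → (n : ℕ) → .{{NonZero n}} → Carrier
  frac i n = (i × 1#) * (1/ n)

record Category o m ℓ : Set (lsuc (o ⊔ m ⊔ ℓ)) where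
  infix  4 _≈_ _⇒_
  infixr 9 _∘_

  field
    Obj : Set o
    _⇒_ : Obj → Obj → Set m
    _≈_ : ∀ {X Y} → Rel (X ⇒ Y) ℓ
    id  : ∀ {X} → X ⇒ X
    _∘_ : ∀ {X Y Z} → Y ⇒ Z → X ⇒ Y → X ⇒ Z

    isEquivalence : ∀ {X Y} → IsEquivalence (_≈_ {X} {Y})
    ∘-cong    : ∀ {X Y Z} {f f′ : Y ⇒ Z} {g g′ : X ⇒ Y} →
                f ≈ f′ → g ≈ g′ → f ∘ g ≈ f′ ∘ g′
    assoc     : ∀ {W X Y Z} (h : Y ⇒ Z) (g : X ⇒ Y) (f : W ⇒ X) →
                (h ∘ g) ∘ f ≈ h ∘ (g ∘ f)
    identityˡ : ∀ {X Y} (f : X ⇒ Y) → id ∘ f ≈ f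
    identityʳ : ∀ {X Y} (f : X ⇒ Y) → f ∘ id ≈ f

module _ {o m ℓ} (C : Category o m ℓ) where
  open Category C

  record Product {I : Set} (X : I → Obj) : Set (o ⊔ m ⊔ ℓ) where
    field
      object  : Obj
      π       : (i : I) → object ⇒ X i
      tuple   : ∀ {W} → ((i : I) → W ⇒ X i) → W ⇒ object
      project : ∀ {W} (f : (i : I) → W ⇒ X i) (i : I) → π i ∘ tuple f ≈ f i
      unique  : ∀ {W} (f : (i : I) → W ⇒ X i) (h : W ⇒ object) →
                (∀ i → π i ∘ h ≈ f i) → h ≈ tuple f

  record Endofunctor (F₀ : Obj → Obj) : Set (o ⊔ m ⊔ ℓ) where
    field
      F₁       : ∀ {X Y} → X ⇒ Y → F₀ X ⇒ F₀ Y
      F-cong   : ∀ {X Y} {f g : X ⇒ Y} → f ≈ g → F₁ f ≈ F₁ g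
      identity : ∀ {X} → F₁ (id {X}) ≈ id
      compose  : ∀ {X Y Z} (g : Y ⇒ Z) (f : X ⇒ Y) → F₁ (g ∘ f) ≈ F₁ g ∘ F₁ f

  Id : Endofunctor idᶠ
  Id = record
    { F₁       = idᶠ
    ; F-cong   = idᶠ
    ; identity = IsEquivalence.refl isEquivalence
    ; compose  = λ _ _ → IsEquivalence.refl isEquivalence
    }

  infixr 9 _∘F_
  _∘F_ : ∀ {F₀ G₀} → Endofunctor F₀ → Endofunctor G₀ → Endofunctor (F₀ ∘ᶠ G₀)
  F ∘F G = record
    { F₁       = F.F₁ ∘ᶠ G.F₁
    ; F-cong   = F.F-cong ∘ᶠ G.F-cong
    ; identity = trans (F.F-cong G.identity) F.identity
    ; compose  = λ g f → trans (F.F-cong (G.compose g f)) (F.compose (G.F₁ g) (G.F₁ f))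
    }
    where
    module F = Endofunctor F
    module G = Endofunctor G
    trans : ∀ {X Y} {f g h : X ⇒ Y} → f ≈ g → g ≈ h → f ≈ h
    trans = IsEquivalence.trans isEquivalence

  IsNatural : ∀ {F₀ G₀} → Endofunctor F₀ → Endofunctor G₀ →
              (∀ X → F₀ X ⇒ G₀ X) → Set (o ⊔ m ⊔ ℓ)
  IsNatural F G α = ∀ {X Y} (f : X ⇒ Y) →
    α Y ∘ Endofunctor.F₁ F f ≈ Endofunctor.F₁ G f ∘ α X

record LeftAdditiveCategory {c ℓr} (R : CommutativeSemiring c ℓr) o m ℓ
       : Set (c ⊔ ℓr ⊔ lsuc (o ⊔ m ⊔ ℓ)) where
  open CommutativeSemiring R using (semiring) renaming (Carrier to K)

  infixr 8 _·_
  infixl 6 _+_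

  field
    category : Category o m ℓ

  open Category category public

  field
    _+_ : ∀ {X Y} → X ⇒ Y → X ⇒ Y → X ⇒ Y
    0⇒  : ∀ {X Y} → X ⇒ Y
    _·_ : ∀ {X Y} → K → X ⇒ Y → X ⇒ Y
    isLeftSemimodule : ∀ {X Y} →
      IsLeftSemimodule semiring (_≈_ {X} {Y}) _+_ 0⇒ _·_

  hom : (X Y : Obj) → LeftSemimodule semiring m ℓ
  hom X Y = record { isLeftSemimodule = isLeftSemimodule {X} {Y} }

  Additive : ∀ {W X Y Z} → (W ⇒ X → Y ⇒ Z) → Set (c ⊔ m ⊔ ℓ)
  Additive {W} {X} {Y} {Z} = LeftSemimoduleMorphisms.IsLeftSemimoduleHomomorphism
    (LeftSemimodule.rawLeftSemimodule (hom W X))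
    (LeftSemimodule.rawLeftSemimodule (hom Y Z))

  field
    precompose-additive : ∀ {X Y Z} (f : X ⇒ Y) →
                          Additive {Y} {Z} {X} {Z} (λ g → g ∘ f)

  AdditiveMorphism : ∀ {Y Z} → Y ⇒ Z → Set (c ⊔ o ⊔ m ⊔ ℓ)
  AdditiveMorphism {Y} {Z} h = ∀ {X} → Additive {X} {Y} {X} {Z} (λ f → h ∘ f)

  record AdditiveProduct {I : Set} (X : I → Obj) : Set (c ⊔ o ⊔ m ⊔ ℓ) where
    field
      product    : Product category X
      π-additive : ∀ i → AdditiveMorphism (Product.π product i)

    open Product product public

  infix 7 _when_
  _when_ : ∀ {X Y p} {P : Set p} → X ⇒ Y → Dec P → X ⇒ Y
  f when P? = if does P? then f else 0⇒

  sum : ∀ {X Y k} → (Fin k → X ⇒ Y) → X ⇒ Y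
  sum {X} {Y} = RawMonoidDefinitions.sum (LeftSemimodule.+ᴹ-rawMonoid (hom X Y))

-- Products are chosen, one for each finite list of objects, so that n-ary
-- products are not built from binary ones.
record CartesianLeftAdditiveCategory {c ℓr} (R : CommutativeSemiring c ℓr) o m ℓ
       : Set (c ⊔ ℓr ⊔ lsuc (o ⊔ m ⊔ ℓ)) where
  field
    leftAdditiveCategory : LeftAdditiveCategory R o m ℓ

  open LeftAdditiveCategory leftAdditiveCategory public

  field
    finiteProduct : ∀ {k} (X : Fin k → Obj) → AdditiveProduct X

module _ {c ℓr o m ℓ} {R : CommutativeSemiring c ℓr}
         (C : CartesianLeftAdditiveCategory R o m ℓ) where
  open CartesianLeftAdditiveCategory C

  Cancellative : Set (o ⊔ m ⊔ ℓ)
  Cancellative = ∀ {X Y} → AlgebraDefinitions.LeftCancellative (_≈_ {X} {Y}) _+_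

  CountablePowers : Set (c ⊔ o ⊔ m ⊔ ℓ)
  CountablePowers = (X : Obj) → AdditiveProduct {ℕ} (λ _ → X)

  -- ℕ ∪ {ω}, where ω is available only together with a choice of
  -- countable powers.
  data Order : Set (c ⊔ o ⊔ m ⊔ ℓ) where
    fin : ℕ → Order
    ω   : CountablePowers → Order

module Differential {c ℓr o m ℓ} {R : CommutativeSemiring c ℓr}
                    (C : CartesianLeftAdditiveCategory R o m ℓ) where
  open CommutativeSemiring R using (rawSemiring) renaming (Carrier to K)
  open RawSemiringDefinitions rawSemiring using (_^_)
  open CartesianLeftAdditiveCategory C

  infix 4 _≤ω_
  _≤ω_ : ℕ → Order C → Set
  k ≤ω fin n = k ℕ.≤ n
  k ≤ω ω _   = ⊤

  Ix : Order C → Set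
  Ix (fin n) = Fin (suc n)
  Ix (ω _)   = ℕ

  deg : ∀ n → Ix n → ℕ
  deg (fin n) k = toℕ k
  deg (ω _)   k = k

  deg≤ : ∀ n (k : Ix n) → deg n k ≤ω n
  deg≤ (fin n) k = toℕ≤pred[n] k
  deg≤ (ω _)   k = tt

  embed : ∀ n {k} → k ≤ω n → Fin (suc k) → Ix n
  embed (fin n) k≤n i = inject≤ i (s≤s k≤n)
  embed (ω _)   _   i = toℕ i

  ix₀ : ∀ n → Ix n
  ix₀ (fin n) = zero
  ix₀ (ω _)   = zero

  ix₁ : ∀ n → 1 ≤ω n → Ix n
  ix₁ n 1≤n = embed n 1≤n (suc zero)

  power : (n : Order C) (X : Obj) → AdditiveProduct {Ix n} (λ _ → X)
  power (fin n)      X = finiteProduct (λ _ → X)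
  power (ω powers) X = powers X

  S : Order C → Obj → Obj
  S n X = AdditiveProduct.object (power n X)

  π : ∀ n {X} → Ix n → S n X ⇒ X
  π n {X} = AdditiveProduct.π (power n X)

  tuple : ∀ n {W X} → (Ix n → W ⇒ X) → W ⇒ S n X
  tuple n {X = X} = AdditiveProduct.tuple (power n X)

  S-map : ∀ n {X Y} → X ⇒ Y → S n X ⇒ S n Y
  S-map n f = tuple n (λ k → f ∘ π n k)

  Sq : Obj → Obj
  Sq = S (fin 1)

  π₀ π₁ : ∀ {X} → Sq X ⇒ X
  π₀ = π (fin 1) zero
  π₁ = π (fin 1) (suc zero)

  ⟨_,_⟩ : ∀ {W X} → W ⇒ X → W ⇒ X → W ⇒ Sq X
  ⟨ x , u ⟩ = tuple (fin 1) (x ∷ u ∷ [])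

  data IsProjection : Order C → ∀ {X Y} → X ⇒ Y → Set (c ⊔ o ⊔ m ⊔ ℓ) where
    finite    : ∀ {n k} (X : Fin k → Obj) (i : Fin k) →
                IsProjection n (AdditiveProduct.π (finiteProduct X) i)
    countable : ∀ {powers} (X : Obj) (i : ℕ) →
                IsProjection (ω powers) (AdditiveProduct.π (powers X) i)

  s : ∀ n {m X} → m ≤ω n → S n X ⇒ S (fin m) X
  s n {m} m≤n = tuple (fin m) (λ k → π n (embed n m≤n k))

  z-component : ∀ {m k X} → Dec (k ℕ.< suc m) → S (fin m) X ⇒ X
  z-component {m} (yes k≤m) = π (fin m) (fromℕ< k≤m)
  z-component     (no  _)   = 0⇒

  z : ∀ m n {X} → S (fin m) X ⇒ S n X
  z m n = tuple n (λ k → z-component (deg n k ℕ.<? suc m))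

  ι : ∀ n {X} → X ⇒ S n X
  ι n = tuple n (λ k → id when (deg n k ℕ.≟ 0))

  -- `opposite` sends i : Fin (suc k) to k - i.
  θ : ∀ n {X} → S n (S n X) ⇒ S n X
  θ n = tuple n (λ k → let below = embed n (deg≤ n k) in
                       sum (λ i → π n (below i) ∘ π n (below (opposite i))))

  exchange : ∀ n {X} → S n (S n X) ⇒ S n (S n X)
  exchange n = tuple n (λ j → tuple n (λ i → π n j ∘ π n i))

  lift : ∀ n {X} → S n X ⇒ S n (S n X)
  lift n = tuple n (λ j → tuple n (λ i → π n i when (deg n i ℕ.≟ deg n j)))

  scale : ∀ n → K → ∀ {X} → S n X ⇒ S n X
  scale n r = tuple n (λ k → (r ^ deg n k) · π n k)

  -- The order n only matters for which projections occur in D-projection.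
  record Derivative (n : Order C) : Set (c ⊔ o ⊔ m ⊔ ℓ) where
    field
      D : ∀ {X Y} → X ⇒ Y → Sq X ⇒ Y

      D-projection : ∀ {X Y} {p : X ⇒ Y} → IsProjection n p → D p ≈ p ∘ π₁
      D-additive   : ∀ {X Y} → Additive {X} {Y} {Sq X} {Y} D
      D-id         : ∀ {X} → D (id {X}) ≈ π₁
      D-∘          : ∀ {X Y Z} (g : Y ⇒ Z) (f : X ⇒ Y) →
                     D (g ∘ f) ≈ D g ∘ ⟨ f ∘ π₀ , D f ⟩
      D-linear     : ∀ {W X Y} (f : X ⇒ Y) (x : W ⇒ X) →
                     Additive {W} {X} {W} {Y} (λ u → D f ∘ ⟨ x , u ⟩)
      D-lift       : ∀ {W X Y} (f : X ⇒ Y) (x u : W ⇒ X) →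
                     D (D f) ∘ ⟨ ⟨ x , 0⇒ ⟩ , ⟨ 0⇒ , u ⟩ ⟩ ≈ D f ∘ ⟨ x , u ⟩
      D-symmetric  : ∀ {W X Y} (f : X ⇒ Y) (x u v w : W ⇒ X) →
                     D (D f) ∘ ⟨ ⟨ x , u ⟩ , ⟨ v , w ⟩ ⟩ ≈
                     D (D f) ∘ ⟨ ⟨ x , v ⟩ , ⟨ u , w ⟩ ⟩

  derivatives : Order C → Setoid (c ⊔ o ⊔ m ⊔ ℓ) (o ⊔ m ⊔ ℓ)
  derivatives n = record
    { Carrier       = Derivative n
    ; _≈_           = λ d e → ∀ {X Y} (f : X ⇒ Y) → Derivative.D d f ≈ Derivative.D e f
    ; isEquivalence = record
      { refl  = λ f → IsEquivalence.refl isEquivalence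
      ; sym   = λ p f → IsEquivalence.sym isEquivalence (p f)
      ; trans = λ p q f → IsEquivalence.trans isEquivalence (p f) (q f)
      }
    }

  record TaylorExpansion (n : Order C) : Set (c ⊔ o ⊔ m ⊔ ℓ) where
    field
      functor : Endofunctor category (S n)

    open Endofunctor functor public renaming (F₁ to U)

    UU : Endofunctor category (S n ∘ᶠ S n)
    UU = _∘F_ category functor functor

    field
      U-projection : ∀ {X Y} {p : X ⇒ Y} → IsProjection n p → U p ≈ S-map n p
      U-+          : ∀ {X} → U (π₀ {X} + π₁) ≈ S-map n (π₀ + π₁)
      U-·          : ∀ {X} (r : K) → U (r · id {X}) ≈ S-map n (r · id)

      π₀-natural       : IsNatural category functor (Id category) (λ _ → π n (ix₀ n))
      ι-natural        : IsNatural category (Id category) functor (λ _ → ι n)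
      θ-natural        : IsNatural category UU functor (λ _ → θ n)
      scale-natural    : ∀ r → IsNatural category functor functor (λ _ → scale n r)
      exchange-natural : IsNatural category UU UU (λ _ → exchange n)
      lift-natural     : IsNatural category functor UU (λ _ → lift n)

  taylorExpansions : Order C → Setoid (c ⊔ o ⊔ m ⊔ ℓ) (o ⊔ m ⊔ ℓ)
  taylorExpansions n = record
    { Carrier       = TaylorExpansion n
    ; _≈_           = λ u v → ∀ {X Y} (f : X ⇒ Y) →
                        TaylorExpansion.U u f ≈ TaylorExpansion.U v f
    ; isEquivalence = record
      { refl  = λ f → IsEquivalence.refl isEquivalence
      ; sym   = λ p f → IsEquivalence.sym isEquivalence (p f)
      ; trans = λ p q f → IsEquivalence.trans isEquivalence (p f) (q f)
      }
    }

  u₁ : ∀ {n} → 1 ≤ω n → TaylorExpansion n → ∀ {X Y} → X ⇒ Y → Sq X ⇒ Y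
  u₁ {n} 1≤n T f = π n (ix₁ n 1≤n) ∘ TaylorExpansion.U T f ∘ z 1 n

  module _ (inverses : IntegerInverses R) where
    open IntegerInverses inverses using (frac)

    -- The index is shifted: ν k is ν_{k+1} in the usual numbering.
    ν : ∀ k {X} → S (fin (suc k)) X ⇒ Sq (S (fin k) X)
    ν k = ⟨ tuple (fin k) (λ j → π (fin (suc k)) (inject₁ j))
          , tuple (fin k) (λ j → frac (suc (toℕ j)) (suc k) · π (fin (suc k)) (suc j))
          ⟩

    module _ {n : Order C} (d : Derivative n) where
      open Derivative d

      -- S_0 X is a chosen unary power, whence the π in the base case.
      t : ∀ k {X Y} → X ⇒ Y → S (fin k) X ⇒ Y
      t zero    f = f ∘ π (fin 0) zero
      t (suc k) f = D (t k f) ∘ ν k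

      T : ∀ {X Y} → X ⇒ Y → S n X ⇒ S n Y
      T f = tuple n (λ i → t (deg n i) f ∘ s n (deg≤ n i))

{-# OPTIONS --safe #-}

-- Write u_k f = π_k ∘ U f for a Taylor expansion U.  Naturality of θ at k = 1
-- shows that u₁ f depends on the first two coefficients only and is additive
-- in the second; the other axioms of a derivative are the naturality of lift
-- and exchange.
--
-- U is determined by u₁: feeding to θ an array with first row and first column
-- y and antidiagonal sums 2^a y_a, naturality of θ and scale gives
-- 2^k u_k f(y) = 2 u_k f(y) + (terms u_j (u_i f) with i + j = k and i, j ≥ 1),
-- and 2^k − 2 can be divided out when k ≥ 2.  Both inverse laws are instances
-- of this uniqueness.
--
-- Conversely, for the coefficients t_k of a derivative D, functoriality is the
-- chain rule, exchange follows from t_j (D g) = D (t_j g) (up to a permutation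
-- of the arguments) and θ from Euler's identity for sums over antidiagonals.
-- Lift rests on ∂t_{j+1}/∂x_{a+1} = ∂t_j/∂x_a, which expresses that D (T g) is
-- linear over power series and whose proof uses cancellation.
module Submission where

open import Defs
open import Algebra.Bundles using (CommutativeMonoid; CommutativeSemiring)
import Algebra.Definitions.RawSemiring as RawSemiringDefinitions
open import Algebra.Module.Bundles using (LeftSemimodule)
open import Algebra.Module.Morphism.Structures using (module LeftSemimoduleMorphisms)
open import Algebra.Module.Structures using (IsLeftSemimodule)
import Algebra.Properties.CommutativeSemigroup as CommutativeSemigroupProperties
import Algebra.Properties.Semiring.Mult as SemiringMult
open import Data.Bool.Base using (true; false)
open import Data.Fin.Base using (Fin; zero; suc; toℕ; fromℕ; fromℕ<; inject₁; opposite)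
import Data.Fin.Properties as Fin
open import Data.Nat.Base as ℕ using (ℕ; zero; suc; z≤n; s≤s; NonZero)
import Data.Nat.Properties as ℕ
open import Data.Nat.Tactic.RingSolver using (solve-∀)
open import Data.Product.Base using (Σ; _×_; _,_)
open import Data.Unit.Base using (tt)
open import Function.Bundles using (Inverse)
open import Level using (Level)
open import Relation.Binary.Bundles using (Setoid)
open import Relation.Binary.PropositionalEquality as ≡ using (_≡_)
import Relation.Binary.Reasoning.Setoid as SetoidReasoning
open import Relation.Binary.Structures using (IsEquivalence)
open import Relation.Nullary.Decidable.Core using (Dec; yes; no; does)
open import Relation.Nullary.Negation.Core using (contradiction)

-- A row `x` is best read as the power series with coefficients `x a` in a formal variable, and
-- `t k f` as the coefficient of degree k of f composed with that series; the fractions in `ν` are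
-- those of the formal derivative, divided by k + 1. The structure maps are then substitutions:
-- `scale` rescales the variable, `θ` identifies two variables, `exchange` swaps them and `lift`
-- inserts their product. Identities between coefficients are stated on rows out of an arbitrary
-- object. Such an identity holds in particular for the generic row of projections, where it is an
-- equation of morphisms and can be differentiated; this is how most inductions on the order proceed
-- (`∂-transfer`). The base 2 of the doubling argument is forced: in an array with first row and
-- first column y, the antidiagonal of degree 1 consists of two border entries, so a scaling that
-- reproduces the antidiagonal sums must multiply the entry of degree 1 by 2.

module LeftAdditive {c ℓr o m ℓ : Level} {R : CommutativeSemiring c ℓr}
                    (A : LeftAdditiveCategory R o m ℓ) where
  open CommutativeSemiring R using (semiring; 1#; *-comm)
    renaming (Carrier to K; trans to transᴷ; reflexive to reflexiveᴷ)
  open SemiringMult semiring using (×-homo-+) renaming (_×_ to _×ᴷ_)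
  open LeftAdditiveCategory A

  -- Calculus in the hom-semimodules

  homSetoid : Obj → Obj → Setoid m ℓ
  homSetoid X Y = record { isEquivalence = isEquivalence {X} {Y} }

  module _ {X Y : Obj} where
    open IsEquivalence (isEquivalence {X} {Y}) public using (refl; sym; trans; reflexive)
    open SetoidReasoning (homSetoid X Y) public
    open IsLeftSemimodule (isLeftSemimodule {X} {Y}) public
      using ()
      renaming ( +ᴹ-cong to +-cong; +ᴹ-comm to +-comm; +ᴹ-assoc to +-assoc
               ; +ᴹ-identityˡ to +-identityˡ; +ᴹ-identityʳ to +-identityʳ
               ; +ᴹ-congˡ to +-congˡ; +ᴹ-congʳ to +-congʳ
               ; *ₗ-cong to ·-cong; *ₗ-congˡ to ·-congˡ; *ₗ-congʳ to ·-congʳ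
               ; *ₗ-zeroˡ to ·-zeroˡ; *ₗ-zeroʳ to ·-zeroʳ
               ; *ₗ-distribˡ to ·-distribˡ; *ₗ-distribʳ to ·-distribʳ
               ; *ₗ-identityˡ to ·-identityˡ; *ₗ-assoc to ·-assoc)

    +-commutativeMonoid : CommutativeMonoid m ℓ
    +-commutativeMonoid = record
      { isCommutativeMonoid = IsLeftSemimodule.+ᴹ-isCommutativeMonoid (isLeftSemimodule {X} {Y}) }

    open CommutativeSemigroupProperties (CommutativeMonoid.commutativeSemigroup +-commutativeMonoid) public
      using () renaming (interchange to +-interchange)

  ∘-congˡ : ∀ {X Y Z} {f : Y ⇒ Z} {g g′ : X ⇒ Y} → g ≈ g′ → f ∘ g ≈ f ∘ g′
  ∘-congˡ = ∘-cong refl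

  ∘-congʳ : ∀ {X Y Z} {f f′ : Y ⇒ Z} {g : X ⇒ Y} → f ≈ f′ → f ∘ g ≈ f′ ∘ g
  ∘-congʳ p = ∘-cong p refl

  module Hom {W X Y Z : Obj} where
    open LeftSemimoduleMorphisms (LeftSemimodule.rawLeftSemimodule (hom W X))
                                 (LeftSemimodule.rawLeftSemimodule (hom Y Z)) public
    open module Fields {φ : W ⇒ X → Y ⇒ Z} (φ-additive : Additive {W} {X} {Y} {Z} φ) =
      IsLeftSemimoduleHomomorphism φ-additive public
      using () renaming (⟦⟧-cong to cong; +ᴹ-homo to +-homo; 0ᴹ-homo to 0-homo; *ₗ-homo to ·-homo)

  mkAdditive : ∀ {W X Y Z} {φ : W ⇒ X → Y ⇒ Z} →
               (∀ {f g} → f ≈ g → φ f ≈ φ g) → (∀ f g → φ (f + g) ≈ φ f + φ g) →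
               φ 0⇒ ≈ 0⇒ → (∀ r f → φ (r · f) ≈ r · φ f) → Additive {W} {X} {Y} {Z} φ
  mkAdditive cong +-homo 0-homo ·-homo = record
    { +ᴹ-isMonoidHomomorphism = record
      { isMagmaHomomorphism = record
        { isRelHomomorphism = record { cong = cong }
        ; homo              = +-homo
        }
      ; ε-homo = 0-homo
      }
    ; *ₗ-homo = ·-homo
    }

  ·-additive : ∀ {X Y} r → Additive {X} {Y} {X} {Y} (r ·_)
  ·-additive r = mkAdditive ·-congˡ (·-distribˡ r) (·-zeroʳ r) λ s f →
    trans (sym (·-assoc r s f)) (trans (·-congʳ (*-comm r s)) (·-assoc s r f))

  +-∘ : ∀ {X Y Z} (f g : Y ⇒ Z) (h : X ⇒ Y) → (f + g) ∘ h ≈ f ∘ h + g ∘ h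
  +-∘ f g h = Hom.+-homo (precompose-additive h) f g

  0-∘ : ∀ {X Y Z} (h : X ⇒ Y) → 0⇒ {Y} {Z} ∘ h ≈ 0⇒
  0-∘ h = Hom.0-homo (precompose-additive h)

  ·-∘ : ∀ {X Y Z} r (f : Y ⇒ Z) (h : X ⇒ Y) → (r · f) ∘ h ≈ r · (f ∘ h)
  ·-∘ r f h = Hom.·-homo (precompose-additive h) r f

  module _ {W X Y Z : Obj} {φ : W ⇒ X → Y ⇒ Z} (φ-0 : φ 0⇒ ≈ 0⇒) where
    when-homo : ∀ {p} {P : Set p} (f : W ⇒ X) (P? : Dec P) → φ (f when P?) ≈ φ f when P?
    when-homo f P? with does P?
    ... | true  = refl
    ... | false = φ-0

  when-∘ : ∀ {X Y Z p} {P : Set p} (f : Y ⇒ Z) (P? : Dec P) (h : X ⇒ Y) →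
           (f when P?) ∘ h ≈ (f ∘ h) when P?
  when-∘ f P? h = when-homo {φ = _∘ h} (0-∘ h) f P?

  when-cong : ∀ {X Y p} {P : Set p} {f g : X ⇒ Y} (P? : Dec P) → f ≈ g → f when P? ≈ g when P?
  when-cong P? f≈g with does P?
  ... | true  = f≈g
  ... | false = refl

  when-0 : ∀ {X Y p} {P : Set p} (P? : Dec P) → 0⇒ {X} {Y} when P? ≈ 0⇒
  when-0 P? with does P?
  ... | true  = refl
  ... | false = refl

  -- Antidiagonal sums and Euler's identity

  conv : ∀ {X Y} → ℕ → (ℕ → ℕ → X ⇒ Y) → X ⇒ Y
  conv zero    F = F 0 0
  conv (suc k) F = F 0 (suc k) + conv k (λ i → F (suc i))

  conv-cong : ∀ {X Y} k {F G : ℕ → ℕ → X ⇒ Y} →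
              (∀ i j → i ℕ.+ j ≡ k → F i j ≈ G i j) → conv k F ≈ conv k G
  conv-cong zero    F≈G = F≈G 0 0 ≡.refl
  conv-cong (suc k) F≈G =
    +-cong (F≈G 0 (suc k) ≡.refl) (conv-cong k λ i j e → F≈G (suc i) j (≡.cong suc e))

  -- The recursion of `conv` peels off the end with first index 0; arguments that treat the two
  -- indices alike need the other end as well.
  conv-last : ∀ {X Y} k (F : ℕ → ℕ → X ⇒ Y) →
              conv (suc k) F ≈ conv k (λ i j → F i (suc j)) + F (suc k) 0
  conv-last zero    F = refl
  conv-last (suc k) F = begin
    F 0 (suc (suc k)) + conv (suc k) (λ i → F (suc i))
      ≈⟨ +-congˡ (conv-last k (λ i → F (suc i))) ⟩
    F 0 (suc (suc k)) + (conv k (λ i j → F (suc i) (suc j)) + F (suc (suc k)) 0)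
      ≈⟨ +-assoc _ _ _ ⟨
    conv (suc k) (λ i j → F i (suc j)) + F (suc (suc k)) 0 ∎

  conv-additive : ∀ {W X Y Z} {φ : W ⇒ X → Y ⇒ Z} → Additive {W} {X} {Y} {Z} φ →
                  ∀ k (F : ℕ → ℕ → W ⇒ X) → φ (conv k F) ≈ conv k (λ i j → φ (F i j))
  conv-additive φ-additive zero    F = refl
  conv-additive φ-additive (suc k) F =
    trans (Hom.+-homo φ-additive _ _) (+-congˡ (conv-additive φ-additive k (λ i → F (suc i))))

  conv-∘ : ∀ {X Y Z} k (F : ℕ → ℕ → Y ⇒ Z) (h : X ⇒ Y) → conv k F ∘ h ≈ conv k (λ i j → F i j ∘ h)
  conv-∘ k F h = conv-additive (precompose-additive h) k F

  conv-+ : ∀ {X Y} k (F G : ℕ → ℕ → X ⇒ Y) →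
           conv k (λ i j → F i j + G i j) ≈ conv k F + conv k G
  conv-+ zero    F G = refl
  conv-+ (suc k) F G =
    trans (+-congˡ (conv-+ k (λ i → F (suc i)) (λ i → G (suc i)))) (+-interchange _ _ _ _)

  conv-firstColumn : ∀ {X Y} k (F : ℕ → ℕ → X ⇒ Y) → (∀ i j → F i (suc j) ≈ 0⇒) → conv k F ≈ F k 0
  conv-firstColumn zero    F F≈0 = refl
  conv-firstColumn (suc k) F F≈0 =
    trans (+-cong (F≈0 0 k) (conv-firstColumn k (λ i → F (suc i)) (λ i → F≈0 (suc i))))
          (+-identityˡ _)

  conv-0 : ∀ {X Y} k {F : ℕ → ℕ → X ⇒ Y} → (∀ i j → F i j ≈ 0⇒) → conv k F ≈ 0⇒
  conv-0 k {F} F≈0 = trans (conv-firstColumn k F (λ i j → F≈0 i (suc j))) (F≈0 k 0)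

  sum-cong : ∀ {X Y k} {f g : Fin k → X ⇒ Y} → (∀ i → f i ≈ g i) → sum f ≈ sum g
  sum-cong {k = zero}  f≈g = refl
  sum-cong {k = suc k} f≈g = +-cong (f≈g zero) (sum-cong (λ i → f≈g (suc i)))

  -- Replaces the `Fin`-indexed sum in `θ` by one whose two indices are natural numbers, which can
  -- be shifted and weighted without conversions.
  sum≈conv : ∀ {X Y} k (F : ℕ → ℕ → X ⇒ Y) →
             sum {k = suc k} (λ i → F (toℕ i) (toℕ (opposite i))) ≈ conv k F
  sum≈conv zero    F = +-identityʳ _
  sum≈conv (suc k) F = +-cong
    (reflexive (≡.cong (F 0) (Fin.toℕ-fromℕ (suc k))))
    (trans (sum-cong {k = suc k} λ i → reflexive (≡.cong (F (suc (toℕ i))) (Fin.toℕ-inject₁ (opposite i))))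
           (sum≈conv k (λ i → F (suc i))))

  nat : ℕ → K
  nat k = k ×ᴷ 1#

  -- On the antidiagonal the weight k + 1 equals i + j. The part weighted by i loses its end i = 0
  -- and the part weighted by j its end j = 0; after reindexing both run over the antidiagonal of
  -- degree k.
  conv-euler : ∀ {X Y} k (F : ℕ → ℕ → X ⇒ Y) →
    nat (suc k) · conv (suc k) F ≈
    conv k (λ i j → nat (suc i) · F (suc i) j + nat (suc j) · F i (suc j))
  conv-euler k F = begin
    nat (suc k) · conv (suc k) F
      ≈⟨ conv-additive (·-additive (nat (suc k))) (suc k) F ⟩
    conv (suc k) (λ i j → nat (suc k) · F i j)
      ≈⟨ conv-cong (suc k) (λ i j e → trans
           (·-congʳ (transᴷ (reflexiveᴷ (≡.cong nat (≡.sym e))) (×-homo-+ 1# i j)))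
           (·-distribʳ (F i j) _ _)) ⟩
    conv (suc k) (λ i j → iF i j + jF i j)
      ≈⟨ conv-+ (suc k) iF jF ⟩
    conv (suc k) iF + conv (suc k) jF
      ≈⟨ +-cong (trans (+-congʳ (·-zeroˡ _)) (+-identityˡ _))
                (trans (conv-last k jF) (trans (+-congˡ (·-zeroˡ _)) (+-identityʳ _))) ⟩
    conv k (λ i j → nat (suc i) · F (suc i) j) + conv k (λ i j → nat (suc j) · F i (suc j))
      ≈⟨ conv-+ k _ _ ⟨
    conv k (λ i j → nat (suc i) · F (suc i) j + nat (suc j) · F i (suc j)) ∎
    where
    iF = λ i j → nat i · F i j
    jF = λ i j → nat j · F i j

  module Division (inverses : IntegerInverses R) where
    open IntegerInverses inverses using (1/_; inverseˡ)

    ·-invert : ∀ k {X Y} (f : X ⇒ Y) → 1/ suc k · nat (suc k) · f ≈ f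
    ·-invert k f = trans (sym (·-assoc _ _ _)) (trans (·-congʳ (inverseˡ (suc k))) (·-identityˡ f))

-- Arithmetic of the fractions i/n in R

module Fractions {c ℓr : Level} {R : CommutativeSemiring c ℓr} (inverses : IntegerInverses R) where
  open CommutativeSemiring R
  open SemiringMult semiring using (×-homo-+) renaming (_×_ to _×ᴷ_)
  open IntegerInverses inverses
  open SetoidReasoning setoid

  inverseʳ : ∀ n .{{_ : NonZero n}} → (n ×ᴷ 1#) * (1/ n) ≈ 1#
  inverseʳ n = trans (*-comm _ _) (inverseˡ n)

  frac-cong : ∀ {i j} n .{{_ : NonZero n}} → i ≡ j → frac i n ≈ frac j n
  frac-cong n i≡j = reflexive (≡.cong (λ i → frac i n) i≡j)

  frac-0 : ∀ n .{{_ : NonZero n}} → frac 0 n ≈ 0#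
  frac-0 n = zeroˡ _

  frac-+ : ∀ i j n .{{_ : NonZero n}} → frac i n + frac j n ≈ frac (i ℕ.+ j) n
  frac-+ i j n = trans (sym (distribʳ _ _ _)) (*-congʳ (sym (×-homo-+ 1# i j)))

  frac-self : ∀ n .{{_ : NonZero n}} → frac n n ≈ 1#
  frac-self = inverseʳ

  frac-* : ∀ i m n .{{_ : NonZero m}} .{{_ : NonZero n}} → frac m n * frac i m ≈ frac i n
  frac-* i m n = begin
    (m ×ᴷ 1# * 1/ n) * (i ×ᴷ 1# * 1/ m) ≈⟨ *-comm _ _ ⟩
    (i ×ᴷ 1# * 1/ m) * (m ×ᴷ 1# * 1/ n) ≈⟨ *-assoc _ _ _ ⟩
    i ×ᴷ 1# * (1/ m * (m ×ᴷ 1# * 1/ n)) ≈⟨ *-congˡ (*-assoc _ _ _) ⟨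
    i ×ᴷ 1# * (1/ m * (m ×ᴷ 1#) * 1/ n) ≈⟨ *-congˡ (*-congʳ (inverseˡ m)) ⟩
    i ×ᴷ 1# * (1# * 1/ n)              ≈⟨ *-congˡ (*-identityˡ _) ⟩
    i ×ᴷ 1# * 1/ n                     ∎

  *-frac : ∀ i n .{{_ : NonZero n}} → (n ×ᴷ 1#) * frac i n ≈ i ×ᴷ 1#
  *-frac i n = begin
    n ×ᴷ 1# * (i ×ᴷ 1# * 1/ n) ≈⟨ *-congˡ (*-comm _ _) ⟩
    n ×ᴷ 1# * (1/ n * (i ×ᴷ 1#)) ≈⟨ *-assoc _ _ _ ⟨
    n ×ᴷ 1# * 1/ n * (i ×ᴷ 1#) ≈⟨ *-congʳ (inverseʳ n) ⟩
    1# * (i ×ᴷ 1#)            ≈⟨ *-identityˡ _ ⟩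
    i ×ᴷ 1#                   ∎

-- Powers of every order as sequences indexed by ℕ

module Powers {c ℓr o m ℓ : Level} {R : CommutativeSemiring c ℓr}
              (C : CartesianLeftAdditiveCategory R o m ℓ) where
  open CommutativeSemiring R using (rawSemiring)
  open RawSemiringDefinitions rawSemiring using (_^_)
  open CartesianLeftAdditiveCategory C
  open LeftAdditive leftAdditiveCategory
  open Differential C

  ≤ω-trans : ∀ n {a b} → a ℕ.≤ b → b ≤ω n → a ≤ω n
  ≤ω-trans (fin n) a≤b b≤n = ℕ.≤-trans a≤b b≤n
  ≤ω-trans (ω _)   a≤b _   = tt

  deg-embed : ∀ n {a} (a≤n : a ≤ω n) (i : Fin (suc a)) → deg n (embed n a≤n i) ≡ toℕ i
  deg-embed (fin n) a≤n i = Fin.toℕ-inject≤ i (s≤s a≤n)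
  deg-embed (ω _)   _   i = ≡.refl

  -- The a-th projection, and 0 beyond the order: this lets tuples be indexed
  -- by ℕ whatever the order is.
  coeff : ∀ n {X} → ℕ → S n X ⇒ X
  coeff (fin n)    a = z-component (a ℕ.<? suc n)
  coeff n@(ω _) a = π n a

  opaque
    -- Opaque, so that unification can recover `x` from `row n x`; the unfolded tuple would only
    -- show `x (deg n k)`.
    row : ∀ n {W X} → (ℕ → W ⇒ X) → W ⇒ S n X
    row n x = tuple n (λ k → x (deg n k))

    tuple-deg : ∀ n {W X} (x : ℕ → W ⇒ X) → tuple n (λ k → x (deg n k)) ≈ row n x
    tuple-deg n x = refl

  -- The decision is a variable so that it can be split by pattern matching.
  z-component-π : ∀ {k a X} (a<? : Dec (a ℕ.< suc k)) (i : Fin (suc k)) → toℕ i ≡ a →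
                  z-component {k} {a} {X} a<? ≈ π (fin k) i
  z-component-π {k} (yes a<k) i i≡a =
    reflexive (≡.cong (π (fin k)) (Fin.toℕ-injective (≡.trans (Fin.toℕ-fromℕ< a<k) (≡.sym i≡a))))
  z-component-π (no a≮k) i ≡.refl = contradiction (Fin.toℕ<n i) a≮k

  coeff-deg : ∀ n {X} (k : Ix n) → coeff n {X} (deg n k) ≈ π n k
  coeff-deg (fin n) k = z-component-π (toℕ k ℕ.<? suc n) k ≡.refl
  coeff-deg (ω _)   k = refl

  coeff-embed : ∀ n {X a} (a≤n : a ≤ω n) (i : Fin (suc a)) →
                coeff n {X} (toℕ i) ≈ π n (embed n a≤n i)
  coeff-embed n a≤n i =
    trans (reflexive (≡.cong (coeff n) (≡.sym (deg-embed n a≤n i)))) (coeff-deg n (embed n a≤n i))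

  coeff-π : ∀ n {X a} (a≤n : a ≤ω n) → coeff n {X} a ≈ π n (embed n a≤n (fromℕ a))
  coeff-π n {a = a} a≤n =
    trans (reflexive (≡.cong (coeff n) (≡.sym (Fin.toℕ-fromℕ a)))) (coeff-embed n a≤n (fromℕ a))

  π-additive : ∀ n {X} (k : Ix n) → AdditiveMorphism (π n {X} k)
  π-additive n k = AdditiveProduct.π-additive (power n _) k

  tuple-cong : ∀ n {W X} {f g : Ix n → W ⇒ X} → (∀ k → f k ≈ g k) → tuple n f ≈ tuple n g
  tuple-cong n {f = f} {g} f≈g = AdditiveProduct.unique (power n _) g (tuple n f)
    (λ k → trans (AdditiveProduct.project (power n _) f k) (f≈g k))

  tuple≈row : ∀ n {W X} {f : Ix n → W ⇒ X} (x : ℕ → W ⇒ X) →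
              (∀ k → f k ≈ x (deg n k)) → tuple n f ≈ row n x
  tuple≈row n x f≈x = trans (tuple-cong n f≈x) (tuple-deg n x)

  coeff-row : ∀ n {W X a} → a ≤ω n → (x : ℕ → W ⇒ X) → coeff n a ∘ row n x ≈ x a
  coeff-row n {a = a} a≤n x = begin
    coeff n a ∘ row n x
      ≈⟨ ∘-cong (coeff-π n a≤n) (sym (tuple-deg n x)) ⟩
    π n (embed n a≤n (fromℕ a)) ∘ tuple n (λ k → x (deg n k))
      ≈⟨ AdditiveProduct.project (power n _) _ _ ⟩
    x (deg n (embed n a≤n (fromℕ a)))
      ≈⟨ reflexive (≡.cong x (≡.trans (deg-embed n a≤n (fromℕ a)) (Fin.toℕ-fromℕ a))) ⟩
    x a                                   ∎

  isProjection : ∀ n {X} k → IsProjection n (π n {X} k)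
  isProjection (fin n) k = finite _ k
  isProjection (ω _)   k = countable _ k

  π-ix₀ : ∀ n {X} → π n {X} (ix₀ n) ≈ coeff n 0
  π-ix₀ (fin n) = sym (coeff-deg (fin n) zero)
  π-ix₀ n@(ω _) = refl

  0≤ω : ∀ n → 0 ≤ω n
  0≤ω (fin n) = z≤n
  0≤ω (ω _)   = tt

  π-row₀ : ∀ {W X} (x : ℕ → W ⇒ X) → π (fin 0) zero ∘ row (fin 0) x ≈ x 0
  π-row₀ x = trans (∘-congʳ (sym (coeff-deg (fin 0) zero))) (coeff-row (fin 0) z≤n x)

  row-unique : ∀ n {W X} {h : W ⇒ S n X} {x : ℕ → W ⇒ X} →
               (∀ a → a ≤ω n → coeff n a ∘ h ≈ x a) → h ≈ row n x
  row-unique n {h = h} {x} h≈x = trans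
    (AdditiveProduct.unique (power n _) _ h
      (λ k → trans (∘-congʳ (sym (coeff-deg n k))) (h≈x (deg n k) (deg≤ n k))))
    (tuple-deg n x)

  row-cong : ∀ n {W X} {x y : ℕ → W ⇒ X} → (∀ a → a ≤ω n → x a ≈ y a) → row n x ≈ row n y
  row-cong n {x = x} {y} x≈y = trans (sym (tuple-deg n x))
    (tuple≈row n y (λ k → x≈y (deg n k) (deg≤ n k)))

  row-coeff : ∀ n {W X} (h : W ⇒ S n X) → row n (λ a → coeff n a ∘ h) ≈ h
  row-coeff n h = sym (row-unique n (λ _ _ → refl))

  row-id : ∀ n {X} → row n (coeff n {X}) ≈ id
  row-id n = trans (row-cong n λ _ _ → sym (identityʳ _)) (row-coeff n id)

  coeff-ext : ∀ n {W X} {h h′ : W ⇒ S n X} →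
              (∀ a → a ≤ω n → coeff n a ∘ h ≈ coeff n a ∘ h′) → h ≈ h′
  coeff-ext n {h′ = h′} h≈h′ = trans (row-unique n h≈h′) (row-coeff n h′)

  row-∘ : ∀ n {V W X} (x : ℕ → W ⇒ X) (h : V ⇒ W) → row n x ∘ h ≈ row n (λ a → x a ∘ h)
  row-∘ n x h = row-unique n (λ a a≤n → trans (sym (assoc _ _ _)) (∘-congʳ (coeff-row n a≤n x)))

  coeff-additive : ∀ n {X} a → a ≤ω n → AdditiveMorphism (coeff n {X} a)
  coeff-additive n a a≤n = mkAdditive
    ∘-congˡ
    (λ f g → trans (∘-congʳ (coeff-π n a≤n)) (trans (Hom.+-homo π-hom f g)
               (sym (+-cong (∘-congʳ (coeff-π n a≤n)) (∘-congʳ (coeff-π n a≤n))))))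
    (trans (∘-congʳ (coeff-π n a≤n)) (Hom.0-homo π-hom))
    (λ r f → trans (∘-congʳ (coeff-π n a≤n)) (trans (Hom.·-homo π-hom r f)
               (sym (·-congˡ (∘-congʳ (coeff-π n a≤n))))))
    where
    π-hom : AdditiveMorphism (π n (embed n a≤n (fromℕ a)))
    π-hom = π-additive n (embed n a≤n (fromℕ a))

  row-+ : ∀ n {W X} (x y : ℕ → W ⇒ X) → row n x + row n y ≈ row n (λ a → x a + y a)
  row-+ n x y = row-unique n λ a a≤n →
    trans (Hom.+-homo (coeff-additive n a a≤n) _ _) (+-cong (coeff-row n a≤n x) (coeff-row n a≤n y))

  row-· : ∀ n {W X} r (x : ℕ → W ⇒ X) → r · row n x ≈ row n (λ a → r · x a)
  row-· n r x = row-unique n λ a a≤n →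
    trans (Hom.·-homo (coeff-additive n a a≤n) _ _) (·-congˡ (coeff-row n a≤n x))

  row-0 : ∀ n {W X} {x : ℕ → W ⇒ X} → (∀ a → a ≤ω n → x a ≈ 0⇒) → row n x ≈ 0⇒
  row-0 n x≈0 = sym (row-unique n λ a a≤n →
    trans (Hom.0-homo (coeff-additive n a a≤n)) (sym (x≈0 a a≤n)))

  π₀-pair : ∀ {W X} (x u : W ⇒ X) → π₀ ∘ ⟨ x , u ⟩ ≈ x
  π₀-pair x u = AdditiveProduct.project (power (fin 1) _) _ zero

  π₁-pair : ∀ {W X} (x u : W ⇒ X) → π₁ ∘ ⟨ x , u ⟩ ≈ u
  π₁-pair x u = AdditiveProduct.project (power (fin 1) _) _ (suc zero)

  pair-unique : ∀ {W X} {x u : W ⇒ X} {h} → π₀ ∘ h ≈ x → π₁ ∘ h ≈ u → h ≈ ⟨ x , u ⟩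
  pair-unique {h = h} p q = AdditiveProduct.unique (power (fin 1) _) _ h
    λ { zero → p ; (suc zero) → q }

  pair-cong : ∀ {W X} {x x′ u u′ : W ⇒ X} → x ≈ x′ → u ≈ u′ → ⟨ x , u ⟩ ≈ ⟨ x′ , u′ ⟩
  pair-cong p q = tuple-cong (fin 1) λ { zero → p ; (suc zero) → q }

  pair-η : ∀ {W X} (h : W ⇒ Sq X) → ⟨ π₀ ∘ h , π₁ ∘ h ⟩ ≈ h
  pair-η h = sym (pair-unique refl refl)

  pair-∘ : ∀ {V W X} (x u : W ⇒ X) (h : V ⇒ W) → ⟨ x , u ⟩ ∘ h ≈ ⟨ x ∘ h , u ∘ h ⟩
  pair-∘ x u h = pair-unique (trans (sym (assoc _ _ _)) (∘-congʳ (π₀-pair x u)))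
                             (trans (sym (assoc _ _ _)) (∘-congʳ (π₁-pair x u)))

  pair-+ : ∀ {W X} (x u y v : W ⇒ X) → ⟨ x , u ⟩ + ⟨ y , v ⟩ ≈ ⟨ x + y , u + v ⟩
  pair-+ x u y v = pair-unique
    (trans (Hom.+-homo (π-additive (fin 1) zero) _ _) (+-cong (π₀-pair x u) (π₀-pair y v)))
    (trans (Hom.+-homo (π-additive (fin 1) (suc zero)) _ _) (+-cong (π₁-pair x u) (π₁-pair y v)))

  pair-· : ∀ {W X} r (x u : W ⇒ X) → r · ⟨ x , u ⟩ ≈ ⟨ r · x , r · u ⟩
  pair-· r x u = pair-unique
    (trans (Hom.·-homo (π-additive (fin 1) zero) _ _) (·-congˡ (π₀-pair x u)))
    (trans (Hom.·-homo (π-additive (fin 1) (suc zero)) _ _) (·-congˡ (π₁-pair x u)))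

  pair-0 : ∀ {W X} → ⟨ 0⇒ {W} {X} , 0⇒ ⟩ ≈ 0⇒
  pair-0 = sym (pair-unique (Hom.0-homo (π-additive (fin 1) zero))
                            (Hom.0-homo (π-additive (fin 1) (suc zero))))

  s≈row : ∀ n {k X} (k≤n : k ≤ω n) → s n {k} {X} k≤n ≈ row (fin k) (coeff n)
  s≈row n {k} k≤n = tuple≈row (fin k) (coeff n) (λ i → sym (coeff-embed n k≤n i))

  z≈row : ∀ k n {X} → z k n {X} ≈ row n (coeff (fin k))
  z≈row k n = tuple-deg n (coeff (fin k))

  ι-∘ : ∀ n {W X} (h : W ⇒ X) → ι n ∘ h ≈ row n (λ a → h when (a ℕ.≟ 0))
  ι-∘ n h = trans (∘-congʳ (tuple-deg n (λ a → id when (a ℕ.≟ 0))))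
    (trans (row-∘ n _ h) (row-cong n λ a _ →
      trans (when-∘ id (a ℕ.≟ 0) h) (when-cong (a ℕ.≟ 0) (identityˡ h))))

  -- The first index is the outer one. Throughout, i denotes an inner and j an outer degree, whence
  -- the order `x j i` under `conv`.
  row₂ : ∀ n {W X} → (ℕ → ℕ → W ⇒ X) → W ⇒ S n (S n X)
  row₂ n x = row n (λ b → row n (x b))

  θ-∘ : ∀ n {W X} (x : ℕ → ℕ → W ⇒ X) →
        θ n ∘ row₂ n x ≈ row n (λ a → conv a (λ i j → x j i))
  θ-∘ n x = begin
    θ n ∘ row₂ n x
      ≈⟨ ∘-congʳ (tuple≈row n (λ a → conv a (λ i j → coeff n i ∘ coeff n j)) λ k → trans
           (sum-cong {k = suc (deg n k)} λ i →
             sym (∘-cong (coeff-embed n (deg≤ n k) i) (coeff-embed n (deg≤ n k) (opposite i))))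
           (sum≈conv (deg n k) (λ i j → coeff n i ∘ coeff n j))) ⟩
    row n (λ a → conv a (λ i j → coeff n i ∘ coeff n j)) ∘ row₂ n x
      ≈⟨ row-∘ n _ _ ⟩
    row n (λ a → conv a (λ i j → coeff n i ∘ coeff n j) ∘ row₂ n x)
      ≈⟨ row-cong n (λ a a≤n → trans (conv-∘ a _ _) (conv-cong a (entry a a≤n))) ⟩
    row n (λ a → conv a (λ i j → x j i)) ∎
    where
    entry : ∀ a → a ≤ω n → ∀ i j → i ℕ.+ j ≡ a → (coeff n i ∘ coeff n j) ∘ row₂ n x ≈ x j i
    -- As i + j = a, both degrees stay within the order, where `coeff` is a genuine projection.
    entry a a≤n i j ≡.refl = begin
      (coeff n i ∘ coeff n j) ∘ row₂ n x ≈⟨ assoc _ _ _ ⟩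
      coeff n i ∘ (coeff n j ∘ row₂ n x)
        ≈⟨ ∘-congˡ (coeff-row n (≤ω-trans n (ℕ.m≤n+m j i) a≤n) _) ⟩
      coeff n i ∘ row n (x j)            ≈⟨ coeff-row n (≤ω-trans n (ℕ.m≤m+n i j) a≤n) _ ⟩
      x j i                              ∎

  exchange-∘ : ∀ n {W X} (x : ℕ → ℕ → W ⇒ X) →
               exchange n ∘ row₂ n x ≈ row₂ n (λ a b → x b a)
  exchange-∘ n x = begin
    exchange n ∘ row₂ n x
      ≈⟨ ∘-congʳ (tuple≈row n (λ j → row n (λ i → coeff n j ∘ coeff n i)) λ j →
           tuple≈row n (λ i → coeff n (deg n j) ∘ coeff n i) λ i →
             sym (∘-cong (coeff-deg n j) (coeff-deg n i))) ⟩
    row n (λ j → row n (λ i → coeff n j ∘ coeff n i)) ∘ row₂ n x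
      ≈⟨ row-∘ n _ _ ⟩
    row n (λ j → row n (λ i → coeff n j ∘ coeff n i) ∘ row₂ n x)
      ≈⟨ row-cong n (λ j j≤n → trans (row-∘ n _ _) (row-cong n λ i i≤n →
           trans (assoc _ _ _) (trans (∘-congˡ (coeff-row n i≤n _)) (coeff-row n j≤n (x i))))) ⟩
    row₂ n (λ a b → x b a) ∎

  lift-∘ : ∀ n {W X} (x : ℕ → W ⇒ X) →
           lift n ∘ row n x ≈ row₂ n (λ b a → x a when (a ℕ.≟ b))
  lift-∘ n x = begin
    lift n ∘ row n x
      ≈⟨ ∘-congʳ (tuple≈row n (λ j → row n (λ i → coeff n i when (i ℕ.≟ j))) λ j →
           tuple≈row n (λ i → coeff n i when (i ℕ.≟ deg n j)) λ i →
             when-cong (deg n i ℕ.≟ deg n j) (sym (coeff-deg n i))) ⟩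
    row n (λ j → row n (λ i → coeff n i when (i ℕ.≟ j))) ∘ row n x
      ≈⟨ row-∘ n _ _ ⟩
    row n (λ j → row n (λ i → coeff n i when (i ℕ.≟ j)) ∘ row n x)
      ≈⟨ row-cong n (λ j _ → trans (row-∘ n _ _) (row-cong n λ i i≤n →
           trans (when-∘ (coeff n i) (i ℕ.≟ j) _) (when-cong (i ℕ.≟ j) (coeff-row n i≤n x)))) ⟩
    row₂ n (λ b a → x a when (a ℕ.≟ b)) ∎

  scale-∘ : ∀ n r {W X} (x : ℕ → W ⇒ X) →
            scale n r ∘ row n x ≈ row n (λ a → (r ^ a) · x a)
  scale-∘ n r x = begin
    scale n r ∘ row n x
      ≈⟨ ∘-congʳ (tuple≈row n (λ a → (r ^ a) · coeff n a) λ k → ·-congˡ (sym (coeff-deg n k))) ⟩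
    row n (λ a → (r ^ a) · coeff n a) ∘ row n x
      ≈⟨ row-∘ n _ _ ⟩
    row n (λ a → ((r ^ a) · coeff n a) ∘ row n x)
      ≈⟨ row-cong n (λ a a≤n → trans (·-∘ _ _ _) (·-congˡ (coeff-row n a≤n x))) ⟩
    row n (λ a → (r ^ a) · x a) ∎

  S-map≈row : ∀ n {X Y} (f : X ⇒ Y) → S-map n f ≈ row n (λ a → f ∘ coeff n a)
  S-map≈row n f = tuple≈row n (λ a → f ∘ coeff n a) λ k → ∘-congˡ (sym (coeff-deg n k))

  coeff-S-map : ∀ n {X Y a} → a ≤ω n → (f : X ⇒ Y) → coeff n a ∘ S-map n f ≈ f ∘ coeff n a
  coeff-S-map n a≤n f = trans (∘-congˡ (S-map≈row n f)) (coeff-row n a≤n _)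

-- Directional derivatives and linear morphisms

module DerivativeProperties
  {c ℓr o m ℓ : Level} {R : CommutativeSemiring c ℓr}
  {C : CartesianLeftAdditiveCategory R o m ℓ} {n : Order C} (d : Differential.Derivative C n) where
  open CartesianLeftAdditiveCategory C
  open LeftAdditive leftAdditiveCategory
  open Differential C
  open Powers C
  open Derivative d

  D-cong : ∀ {X Y} {f g : X ⇒ Y} → f ≈ g → D f ≈ D g
  D-cong = Hom.cong D-additive

  ∂ : ∀ {W X Y} → X ⇒ Y → W ⇒ X → W ⇒ X → W ⇒ Y
  ∂ f x u = D f ∘ ⟨ x , u ⟩

  ∂-cong : ∀ {W X Y} {f g : X ⇒ Y} {x y u v : W ⇒ X} → f ≈ g → x ≈ y → u ≈ v → ∂ f x u ≈ ∂ g y v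
  ∂-cong f≈g x≈y u≈v = ∘-cong (D-cong f≈g) (pair-cong x≈y u≈v)

  ∂-congˡ : ∀ {W X Y} (f : X ⇒ Y) {x y u v : W ⇒ X} → x ≈ y → u ≈ v → ∂ f x u ≈ ∂ f y v
  ∂-congˡ f = ∂-cong refl

  ∂-∘ : ∀ {V W X Y} (f : X ⇒ Y) (x u : W ⇒ X) (h : V ⇒ W) → ∂ f x u ∘ h ≈ ∂ f (x ∘ h) (u ∘ h)
  ∂-∘ f x u h = trans (assoc _ _ _) (∘-congˡ (pair-∘ x u h))

  ∂-+ : ∀ {W X Y} (f : X ⇒ Y) (x u v : W ⇒ X) → ∂ f x (u + v) ≈ ∂ f x u + ∂ f x v
  ∂-+ f x = Hom.+-homo (D-linear f x)

  ∂-· : ∀ {W X Y} (f : X ⇒ Y) (x : W ⇒ X) r (u : W ⇒ X) → ∂ f x (r · u) ≈ r · ∂ f x u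
  ∂-· f x = Hom.·-homo (D-linear f x)

  ∂-0 : ∀ {W X Y} (f : X ⇒ Y) (x : W ⇒ X) → ∂ f x 0⇒ ≈ 0⇒
  ∂-0 f x = Hom.0-homo (D-linear f x)

  -- By additivity it suffices to treat the direction ⟨0, w⟩. Symmetry moves u from the base point
  -- into the direction, which becomes ⟨u, w⟩ over ⟨x, 0⟩. There the part ⟨u, 0⟩ vanishes, since
  -- another use of symmetry turns its direction into 0, and the part ⟨0, w⟩ is the case of
  -- `D-lift`. In classical terms: `D f` is linear in its second argument.
  ∂∂-split : ∀ {W X Y} (f : X ⇒ Y) (x u v w : W ⇒ X) →
             ∂ (D f) ⟨ x , u ⟩ ⟨ v , w ⟩ ≈ ∂ (D f) ⟨ x , u ⟩ ⟨ v , 0⇒ ⟩ + ∂ f x w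
  ∂∂-split f x u v w = begin
    ∂ (D f) ⟨ x , u ⟩ ⟨ v , w ⟩
      ≈⟨ ∂-congˡ (D f) refl (trans (pair-cong (sym (+-identityʳ v)) (sym (+-identityˡ w)))
                                   (sym (pair-+ _ _ _ _))) ⟩
    ∂ (D f) ⟨ x , u ⟩ (⟨ v , 0⇒ ⟩ + ⟨ 0⇒ , w ⟩)
      ≈⟨ ∂-+ (D f) _ _ _ ⟩
    ∂ (D f) ⟨ x , u ⟩ ⟨ v , 0⇒ ⟩ + ∂ (D f) ⟨ x , u ⟩ ⟨ 0⇒ , w ⟩
      ≈⟨ +-congˡ second ⟩
    ∂ (D f) ⟨ x , u ⟩ ⟨ v , 0⇒ ⟩ + ∂ f x w ∎
    where
    second : ∂ (D f) ⟨ x , u ⟩ ⟨ 0⇒ , w ⟩ ≈ ∂ f x w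
    second = begin
      ∂ (D f) ⟨ x , u ⟩ ⟨ 0⇒ , w ⟩
        ≈⟨ D-symmetric f x u 0⇒ w ⟩
      ∂ (D f) ⟨ x , 0⇒ ⟩ ⟨ u , w ⟩
        ≈⟨ ∂-congˡ (D f) refl (trans (pair-cong (sym (+-identityʳ u)) (sym (+-identityˡ w)))
                                     (sym (pair-+ _ _ _ _))) ⟩
      ∂ (D f) ⟨ x , 0⇒ ⟩ (⟨ u , 0⇒ ⟩ + ⟨ 0⇒ , w ⟩)
        ≈⟨ ∂-+ (D f) _ _ _ ⟩
      ∂ (D f) ⟨ x , 0⇒ ⟩ ⟨ u , 0⇒ ⟩ + ∂ (D f) ⟨ x , 0⇒ ⟩ ⟨ 0⇒ , w ⟩
        ≈⟨ +-cong (trans (D-symmetric f x 0⇒ u 0⇒)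
                         (trans (∂-congˡ (D f) refl pair-0) (∂-0 (D f) _)))
                  (D-lift f x w) ⟩
      0⇒ + ∂ f x w
        ≈⟨ +-identityˡ _ ⟩
      ∂ f x w ∎

  -- Linearity in the sense of differential categories: the derivative at every point is the
  -- morphism itself. It implies additivity through `D-linear`.
  Linear : ∀ {X Y} → X ⇒ Y → Set ℓ
  Linear h = D h ≈ h ∘ π₁

  linear-cong : ∀ {X Y} {g h : X ⇒ Y} → g ≈ h → Linear g → Linear h
  linear-cong g≈h g-linear = trans (D-cong (sym g≈h)) (trans g-linear (∘-congʳ g≈h))

  ∂-linear : ∀ {W X Y} {h : X ⇒ Y} → Linear h → (x u : W ⇒ X) → ∂ h x u ≈ h ∘ u
  ∂-linear h-linear x u =
    trans (∘-congʳ h-linear) (trans (assoc _ _ _) (∘-congˡ (π₁-pair x u)))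

  D-∘-linear : ∀ {X Y Z} (f : Y ⇒ Z) {h : X ⇒ Y} → Linear h → D (f ∘ h) ≈ ∂ f (h ∘ π₀) (h ∘ π₁)
  D-∘-linear f h-linear = trans (D-∘ f _) (∘-congˡ (pair-cong refl h-linear))

  ∂-∘-linear : ∀ {W X Y Z} (f : Y ⇒ Z) {h : X ⇒ Y} → Linear h → (x u : W ⇒ X) →
               ∂ (f ∘ h) x u ≈ ∂ f (h ∘ x) (h ∘ u)
  ∂-∘-linear f h-linear x u = begin
    ∂ (f ∘ _) x u                          ≈⟨ ∘-congʳ (D-∘-linear f h-linear) ⟩
    ∂ f (_ ∘ π₀) (_ ∘ π₁) ∘ ⟨ x , u ⟩       ≈⟨ ∂-∘ f _ _ _ ⟩
    ∂ f ((_ ∘ π₀) ∘ _) ((_ ∘ π₁) ∘ _)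
      ≈⟨ ∂-congˡ f (trans (assoc _ _ _) (∘-congˡ (π₀-pair x u)))
                   (trans (assoc _ _ _) (∘-congˡ (π₁-pair x u))) ⟩
    ∂ f (_ ∘ x) (_ ∘ u)                    ∎

  D-linear-∘ : ∀ {X Y Z} {h : Y ⇒ Z} → Linear h → (f : X ⇒ Y) → D (h ∘ f) ≈ h ∘ D f
  D-linear-∘ h-linear f = trans (D-∘ _ f) (∂-linear h-linear _ _)

  linear-∘ : ∀ {X Y Z} {g : Y ⇒ Z} {h : X ⇒ Y} → Linear g → Linear h → Linear (g ∘ h)
  linear-∘ g-linear h-linear =
    trans (D-linear-∘ g-linear _) (trans (∘-congˡ h-linear) (sym (assoc _ _ _)))

  linear-id : ∀ {X} → Linear (id {X})
  linear-id = trans D-id (sym (identityˡ _))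

  linear-0 : ∀ {X Y} → Linear (0⇒ {X} {Y})
  linear-0 = trans (Hom.0-homo D-additive) (sym (0-∘ _))

  linear-+ : ∀ {X Y} {g h : X ⇒ Y} → Linear g → Linear h → Linear (g + h)
  linear-+ g-linear h-linear =
    trans (Hom.+-homo D-additive _ _) (trans (+-cong g-linear h-linear) (sym (+-∘ _ _ _)))

  linear-· : ∀ {X Y} r {h : X ⇒ Y} → Linear h → Linear (r · h)
  linear-· r h-linear =
    trans (Hom.·-homo D-additive r _) (trans (·-congˡ h-linear) (sym (·-∘ _ _ _)))

  linear-π : ∀ k {X} (i : Fin (suc k)) → Linear (π (fin k) {X} i)
  linear-π k i = D-projection (finite _ i)

  linear-coeff : ∀ k {X} a → Linear (coeff (fin k) {X} a)
  linear-coeff k a = go (a ℕ.<? suc k)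
    where
    go : ∀ {X} (a<? : Dec (a ℕ.< suc k)) → Linear (z-component {k} {a} {X} a<?)
    go (yes a<k) = linear-π k (fromℕ< a<k)
    go (no  _)   = linear-0

  D-row : ∀ k {X Y} (x : ℕ → X ⇒ Y) → D (row (fin k) x) ≈ row (fin k) (λ a → D (x a))
  D-row k x = row-unique (fin k) λ a a≤k →
    trans (sym (D-linear-∘ (linear-coeff k a) _)) (D-cong (coeff-row (fin k) a≤k x))

  linear-row : ∀ k {X Y} {x : ℕ → X ⇒ Y} → (∀ a → a ℕ.≤ k → Linear (x a)) → Linear (row (fin k) x)
  linear-row k {x = x} x-linear = trans (D-row k x)
    (trans (row-cong (fin k) x-linear) (sym (row-∘ (fin k) x π₁)))

  linear-pair : ∀ {X Y} {x u : X ⇒ Y} → Linear x → Linear u → Linear ⟨ x , u ⟩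
  linear-pair {x = x} {u} x-linear u-linear = trans
    (pair-unique
      (trans (sym (D-linear-∘ (linear-π 1 zero) _)) (trans (D-cong (π₀-pair x u)) x-linear))
      (trans (sym (D-linear-∘ (linear-π 1 (suc zero)) _)) (trans (D-cong (π₁-pair x u)) u-linear)))
    (sym (pair-∘ x u π₁))

  D-when : ∀ {X Y p} {P : Set p} (f : X ⇒ Y) (P? : Dec P) → D (f when P?) ≈ D f when P?
  D-when f P? = when-homo (Hom.0-homo D-additive) f P?

  -- The tool for differentiating an induction hypothesis. Taken at the generic row or array, the
  -- hypothesis has the form f ∘ p ≈ g ∘ q with p and q linear rearrangements of the arguments; its
  -- derivative is then evaluated at x along u. The last four equations put the rearranged arguments
  -- into the desired form.
  ∂-transfer : ∀ {V W A B Y} {f : A ⇒ Y} {g : B ⇒ Y} {p : W ⇒ A} {q : W ⇒ B} →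
               Linear p → Linear q → f ∘ p ≈ g ∘ q → (x u : V ⇒ W) →
               ∀ {px pu qx qu} → p ∘ x ≈ px → p ∘ u ≈ pu → q ∘ x ≈ qx → q ∘ u ≈ qu →
               ∂ f px pu ≈ ∂ g qx qu
  ∂-transfer {f = f} {g} {p} {q} p-linear q-linear fp≈gq x u {px} {pu} {qx} {qu} e₁ e₂ e₃ e₄ = begin
    ∂ f px pu             ≈⟨ ∂-congˡ f e₁ e₂ ⟨
    ∂ f (p ∘ x) (p ∘ u)   ≈⟨ ∂-∘-linear f p-linear x u ⟨
    ∂ (f ∘ p) x u         ≈⟨ ∂-cong fp≈gq refl refl ⟩
    ∂ (g ∘ q) x u         ≈⟨ ∂-∘-linear g q-linear x u ⟩
    ∂ g (q ∘ x) (q ∘ u)   ≈⟨ ∂-congˡ g e₃ e₄ ⟩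
    ∂ g qx qu             ∎

-- Taylor coefficients of a derivative

module TaylorCoefficients
  {c ℓr o m ℓ : Level} {R : CommutativeSemiring c ℓr} (inverses : IntegerInverses R)
  {C : CartesianLeftAdditiveCategory R o m ℓ} {n : Order C} (d : Differential.Derivative C n) where
  open CommutativeSemiring R using (rawSemiring; 1#; *-comm)
    renaming (sym to symᴷ; trans to transᴷ; _+_ to _⊕_; _*_ to _⊗_)
  open RawSemiringDefinitions rawSemiring using (_^_)
  open IntegerInverses inverses using (frac; 1/_)
  open Fractions inverses
  open CartesianLeftAdditiveCategory C
  open LeftAdditive leftAdditiveCategory
  open Division inverses
  open Differential C hiding (t)
  open Powers C
  open Derivative d
  open DerivativeProperties d

  t : ∀ k {X Y} → X ⇒ Y → S (fin k) X ⇒ Y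
  t k = Differential.t C inverses d k

  -- The coefficients of the formal derivative of the power series x, divided by k + 1. Thus `ν`
  -- pairs a truncated series with a multiple of its derivative.
  next : ℕ → ∀ {W X} → (ℕ → W ⇒ X) → ℕ → W ⇒ X
  next k x a = frac (suc a) (suc k) · x (suc a)

  restrict : ∀ n {j W X} → j ≤ω n → (x : ℕ → W ⇒ X) →
             row (fin j) (coeff n) ∘ row n x ≈ row (fin j) x
  restrict n j≤n x = trans (row-∘ (fin _) _ _)
    (row-cong (fin _) λ a a≤j → coeff-row n (≤ω-trans n a≤j j≤n) x)

  -- The directions belonging to different orders are proportional. Hence `t j f`, differentiated
  -- along the direction meant for order k, gives a multiple of `t (suc j) f`.
  frac-next : ∀ j k {W X} (x : ℕ → W ⇒ X) a →
              frac (suc j) (suc k) · next j x a ≈ next k x a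
  frac-next j k x a = trans (sym (·-assoc _ _ _)) (·-congʳ (frac-* (suc a) (suc j) (suc k)))

  ν≈pair : ∀ k {X} → ν inverses k {X} ≈
           ⟨ row (fin k) (coeff (fin (suc k))) , row (fin k) (next k (coeff (fin (suc k)))) ⟩
  ν≈pair k = pair-cong
    (tuple≈row (fin k) (coeff (fin (suc k))) λ j → sym
      (trans (reflexive (≡.cong (coeff (fin (suc k))) (≡.sym (Fin.toℕ-inject₁ j))))
             (coeff-deg (fin (suc k)) (inject₁ j))))
    (tuple≈row (fin k) (next k (coeff (fin (suc k)))) λ j →
      ·-congˡ (sym (coeff-deg (fin (suc k)) (suc j))))

  linear-ν : ∀ k {X} → Linear (ν inverses k {X})
  linear-ν k = linear-cong (sym (ν≈pair k)) (linear-pair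
    (linear-row k λ a _ → linear-coeff (suc k) a)
    (linear-row k λ a _ → linear-· _ (linear-coeff (suc k) (suc a))))

  ν-row : ∀ k {W X} (x : ℕ → W ⇒ X) →
          ν inverses k ∘ row (fin (suc k)) x ≈ ⟨ row (fin k) x , row (fin k) (next k x) ⟩
  ν-row k x = trans (∘-congʳ (ν≈pair k)) (trans (pair-∘ _ _ _) (pair-cong
    (restrict (fin (suc k)) (ℕ.n≤1+n k) x)
    (trans (row-∘ (fin k) _ _) (row-cong (fin k) λ a a≤k →
      trans (·-∘ _ _ _) (·-congˡ (coeff-row (fin (suc k)) (s≤s a≤k) x))))))

  t-cong : ∀ k {X Y} {f g : X ⇒ Y} → f ≈ g → t k f ≈ t k g
  t-cong zero    f≈g = ∘-congʳ f≈g
  t-cong (suc k) f≈g = ∘-congʳ (D-cong (t-cong k f≈g))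

  t-zero-row : ∀ {W X Y} (f : X ⇒ Y) (x : ℕ → W ⇒ X) → t 0 f ∘ row (fin 0) x ≈ f ∘ x 0
  t-zero-row f x = trans (assoc _ _ _) (∘-congˡ (π-row₀ x))

  t-suc-row : ∀ k {W X Y} (f : X ⇒ Y) (x : ℕ → W ⇒ X) →
              t (suc k) f ∘ row (fin (suc k)) x ≈ ∂ (t k f) (row (fin k) x) (row (fin k) (next k x))
  t-suc-row k f x = trans (assoc _ _ _) (∘-congˡ (ν-row k x))

  ∂-t-suc : ∀ k {W X Y} (f : X ⇒ Y) (x u : ℕ → W ⇒ X) →
            ∂ (t (suc k) f) (row (fin (suc k)) x) (row (fin (suc k)) u) ≈
            ∂ (D (t k f)) ⟨ row (fin k) x , row (fin k) (next k x) ⟩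
                          ⟨ row (fin k) u , row (fin k) (next k u) ⟩
  ∂-t-suc k f x u = trans (∂-∘-linear _ (linear-ν k) _ _) (∂-congˡ _ (ν-row k x) (ν-row k u))

  t-linear-∘ : ∀ k {X Y Z} {h : Y ⇒ Z} → Linear h → (f : X ⇒ Y) → t k (h ∘ f) ≈ h ∘ t k f
  t-linear-∘ zero    h-linear f = assoc _ _ _
  t-linear-∘ (suc k) h-linear f = trans
    (∘-congʳ (trans (D-cong (t-linear-∘ k h-linear f)) (D-linear-∘ h-linear _))) (assoc _ _ _)

  -- A linear morphism forgets the base point and keeps the direction, whose top coefficient has the
  -- weight (k + 1)/(k + 1).
  t-linear : ∀ k {X Y} {h : X ⇒ Y} → Linear h → t k h ≈ h ∘ coeff (fin k) k
  t-linear zero    h-linear = ∘-congˡ (sym (coeff-deg (fin 0) zero))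
  t-linear (suc k) {h = h} h-linear = begin
    D (t k h) ∘ ν inverses k
      ≈⟨ ∘-cong (D-cong (t-linear k h-linear)) (ν≈pair k) ⟩
    ∂ (h ∘ coeff (fin k) k) (row (fin k) gen) (row (fin k) (next k gen))
      ≈⟨ ∂-linear (linear-∘ h-linear (linear-coeff k k)) _ _ ⟩
    (h ∘ coeff (fin k) k) ∘ row (fin k) (next k gen)
      ≈⟨ assoc _ _ _ ⟩
    h ∘ (coeff (fin k) k ∘ row (fin k) (next k gen))
      ≈⟨ ∘-congˡ (coeff-row (fin k) ℕ.≤-refl _) ⟩
    h ∘ (frac (suc k) (suc k) · gen (suc k))
      ≈⟨ ∘-congˡ (trans (·-congʳ (frac-self (suc k))) (·-identityˡ _)) ⟩
    h ∘ gen (suc k) ∎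
    where gen = coeff (fin (suc k))

  -- The direction obtained by differentiating the inner coefficients is again of the form
  -- `next k y`: its entry j is (j + 1)/(k + 1) times the coefficient of degree j + 1. So the chain
  -- rule for D yields exactly the arguments that `t (suc k) g` expects.
  t-∘ : ∀ k {X Y Z} (g : Y ⇒ Z) (f : X ⇒ Y) →
        t k (g ∘ f) ≈ t k g ∘ row (fin k) (λ j → t j f ∘ row (fin j) (coeff (fin k)))
  t-∘ zero    g f = begin
    (g ∘ f) ∘ π (fin 0) zero
      ≈⟨ assoc _ _ _ ⟩
    g ∘ t 0 f
      ≈⟨ ∘-congˡ (trans (∘-congˡ (row-id (fin 0))) (identityʳ _)) ⟨
    g ∘ (t 0 f ∘ row (fin 0) (coeff (fin 0)))
      ≈⟨ t-zero-row g (λ j → t j f ∘ row (fin j) (coeff (fin 0))) ⟨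
    t 0 g ∘ row (fin 0) (λ j → t j f ∘ row (fin j) (coeff (fin 0))) ∎
  t-∘ (suc k) g f = begin
    D (t k (g ∘ f)) ∘ ν inverses k
      ≈⟨ ∘-cong (trans (D-cong (t-∘ k g f)) (D-∘ _ _)) (ν≈pair k) ⟩
    ∂ (t k g) (tk ∘ π₀) (D tk) ∘ ⟨ row (fin k) gen , row (fin k) (next k gen) ⟩
      ≈⟨ ∂-∘ (t k g) _ _ _ ⟩
    ∂ (t k g) ((tk ∘ π₀) ∘ ⟨ row (fin k) gen , row (fin k) (next k gen) ⟩)
              (∂ tk (row (fin k) gen) (row (fin k) (next k gen)))
      ≈⟨ ∂-congˡ (t k g) (trans (assoc _ _ _) (trans (∘-congˡ (π₀-pair _ _)) base)) tangent ⟩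
    ∂ (t k g) (row (fin k) y) (row (fin k) (next k y))
      ≈⟨ t-suc-row k g y ⟨
    t (suc k) g ∘ row (fin (suc k)) y ∎
    where
    gen = coeff (fin (suc k))
    tk = row (fin k) (λ j → t j f ∘ row (fin j) (coeff (fin k)))
    y = λ j → t j f ∘ row (fin j) gen

    base : tk ∘ row (fin k) gen ≈ row (fin k) y
    base = trans (row-∘ (fin k) _ _) (row-cong (fin k) λ j j≤k →
      trans (assoc _ _ _) (∘-congˡ (restrict (fin k) j≤k gen)))

    tangent-entry : ∀ j → j ℕ.≤ k →
      ∂ (t j f ∘ row (fin j) (coeff (fin k))) (row (fin k) gen) (row (fin k) (next k gen)) ≈ next k y j
    tangent-entry j j≤k = begin
      ∂ (t j f ∘ row (fin j) (coeff (fin k))) (row (fin k) gen) (row (fin k) (next k gen))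
        ≈⟨ ∂-∘-linear (t j f) (linear-row j (λ a _ → linear-coeff k a)) _ _ ⟩
      ∂ (t j f) (row (fin j) (coeff (fin k)) ∘ row (fin k) gen)
                (row (fin j) (coeff (fin k)) ∘ row (fin k) (next k gen))
        ≈⟨ ∂-congˡ (t j f) (restrict (fin k) j≤k _) (restrict (fin k) j≤k _) ⟩
      ∂ (t j f) (row (fin j) gen) (row (fin j) (next k gen))
        ≈⟨ ∂-congˡ (t j f) refl (trans (row-· (fin j) _ _)
             (row-cong (fin j) λ a _ → frac-next j k gen a)) ⟨
      ∂ (t j f) (row (fin j) gen) (frac (suc j) (suc k) · row (fin j) (next j gen))
        ≈⟨ ∂-· (t j f) _ _ _ ⟩
      frac (suc j) (suc k) · ∂ (t j f) (row (fin j) gen) (row (fin j) (next j gen))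
        ≈⟨ ·-congˡ (t-suc-row j f gen) ⟨
      next k y j ∎

    tangent : ∂ tk (row (fin k) gen) (row (fin k) (next k gen)) ≈ row (fin k) (next k y)
    tangent = trans (∘-congʳ (D-row k _)) (trans (row-∘ (fin k) _ _) (row-cong (fin k) tangent-entry))

  t-∘-linear-row : ∀ k {W X Y Z} (g : Y ⇒ Z) {h : X ⇒ Y} → Linear h → (x : ℕ → W ⇒ X) →
                   t k (g ∘ h) ∘ row (fin k) x ≈ t k g ∘ row (fin k) (λ a → h ∘ x a)
  t-∘-linear-row k g {h} h-linear x = begin
    t k (g ∘ h) ∘ row (fin k) x
      ≈⟨ ∘-congʳ (t-∘ k g h) ⟩
    (t k g ∘ row (fin k) (λ j → t j h ∘ row (fin j) (coeff (fin k)))) ∘ row (fin k) x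
      ≈⟨ assoc _ _ _ ⟩
    t k g ∘ (row (fin k) (λ j → t j h ∘ row (fin j) (coeff (fin k))) ∘ row (fin k) x)
      ≈⟨ ∘-congˡ (trans (row-∘ (fin k) _ _) (row-cong (fin k) entry)) ⟩
    t k g ∘ row (fin k) (λ a → h ∘ x a) ∎
    where
    entry : ∀ j → j ℕ.≤ k → (t j h ∘ row (fin j) (coeff (fin k))) ∘ row (fin k) x ≈ h ∘ x j
    entry j j≤k = begin
      (t j h ∘ row (fin j) (coeff (fin k))) ∘ row (fin k) x
        ≈⟨ trans (assoc _ _ _) (∘-cong (t-linear j h-linear) (restrict (fin k) j≤k x)) ⟩
      (h ∘ coeff (fin j) j) ∘ row (fin j) x
        ≈⟨ trans (assoc _ _ _) (∘-congˡ (coeff-row (fin j) ℕ.≤-refl x)) ⟩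
      h ∘ x j ∎

  t-constant : ∀ k {W X Y} (f : X ⇒ Y) (x : W ⇒ X) →
               t k f ∘ row (fin k) (λ a → x when (a ℕ.≟ 0)) ≈ f ∘ x when (k ℕ.≟ 0)
  t-constant zero    f x = t-zero-row f _
  t-constant (suc k) f x = trans (t-suc-row k f _)
    (trans (∂-congˡ (t k f) refl (row-0 (fin k) λ a _ → ·-zeroʳ _)) (∂-0 (t k f) _))

  -- Each entry of the direction comes from one degree higher, so a factor r splits off. The
  -- remaining weights r^a form the linear map `scaled`, along which the induction hypothesis is
  -- differentiated.
  t-scale : ∀ k r {W X Y} (f : X ⇒ Y) (x : ℕ → W ⇒ X) →
            t k f ∘ row (fin k) (λ a → (r ^ a) · x a) ≈ (r ^ k) · (t k f ∘ row (fin k) x)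
  t-scale zero    r f x = begin
    t 0 f ∘ row (fin 0) (λ a → (r ^ a) · x a) ≈⟨ t-zero-row f _ ⟩
    f ∘ (1# · x 0)                            ≈⟨ ∘-congˡ (·-identityˡ _) ⟩
    f ∘ x 0                                   ≈⟨ t-zero-row f x ⟨
    t 0 f ∘ row (fin 0) x                     ≈⟨ ·-identityˡ _ ⟨
    1# · (t 0 f ∘ row (fin 0) x)              ∎
  t-scale (suc k) r f x = begin
    t (suc k) f ∘ row (fin (suc k)) (λ a → (r ^ a) · x a)
      ≈⟨ t-suc-row k f _ ⟩
    ∂ (t k f) (row (fin k) (λ a → (r ^ a) · x a)) (row (fin k) (next k (λ a → (r ^ a) · x a)))
      ≈⟨ ∂-congˡ (t k f) refl (trans (row-cong (fin k) λ a _ → rescale a) (sym (row-· (fin k) r _))) ⟩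
    ∂ (t k f) (row (fin k) (λ a → (r ^ a) · x a)) (r · row (fin k) (λ a → (r ^ a) · next k x a))
      ≈⟨ ∂-· (t k f) _ r _ ⟩
    r · ∂ (t k f) (row (fin k) (λ a → (r ^ a) · x a)) (row (fin k) (λ a → (r ^ a) · next k x a))
      ≈⟨ ·-congˡ derived ⟩
    r · (r ^ k) · ∂ (t k f) (row (fin k) x) (row (fin k) (next k x))
      ≈⟨ ·-assoc _ _ _ ⟨
    (r ^ suc k) · ∂ (t k f) (row (fin k) x) (row (fin k) (next k x))
      ≈⟨ ·-congˡ (t-suc-row k f x) ⟨
    (r ^ suc k) · (t (suc k) f ∘ row (fin (suc k)) x) ∎
    where
    gen = coeff (fin k)
    scaled = row (fin k) (λ a → (r ^ a) · gen a)

    rescale : ∀ a → next k (λ a → (r ^ a) · x a) a ≈ r · (r ^ a) · next k x a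
    rescale a = begin
      frac (suc a) (suc k) · (r ^ suc a) · x (suc a) ≈⟨ ·-assoc _ _ _ ⟨
      (frac (suc a) (suc k) ⊗ (r ^ suc a)) · x (suc a) ≈⟨ ·-congʳ (*-comm _ _) ⟩
      ((r ^ suc a) ⊗ frac (suc a) (suc k)) · x (suc a) ≈⟨ ·-assoc _ _ _ ⟩
      (r ^ suc a) · next k x a                        ≈⟨ ·-assoc _ _ _ ⟩
      r · (r ^ a) · next k x a                        ∎

    scaled-row : ∀ {V} (y : ℕ → V ⇒ _) → scaled ∘ row (fin k) y ≈ row (fin k) (λ a → (r ^ a) · y a)
    scaled-row y = trans (row-∘ (fin k) _ _) (row-cong (fin k) λ a a≤k →
      trans (·-∘ _ _ _) (·-congˡ (coeff-row (fin k) a≤k y)))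

    derived : ∂ (t k f) (row (fin k) (λ a → (r ^ a) · x a)) (row (fin k) (λ a → (r ^ a) · next k x a)) ≈
              (r ^ k) · ∂ (t k f) (row (fin k) x) (row (fin k) (next k x))
    derived = begin
      ∂ (t k f) (row (fin k) (λ a → (r ^ a) · x a)) (row (fin k) (λ a → (r ^ a) · next k x a))
        ≈⟨ ∂-congˡ (t k f) (scaled-row x) (scaled-row (next k x)) ⟨
      ∂ (t k f) (scaled ∘ row (fin k) x) (scaled ∘ row (fin k) (next k x))
        ≈⟨ ∂-∘-linear (t k f) (linear-row k λ a _ → linear-· _ (linear-coeff k a)) _ _ ⟨
      ∂ (t k f ∘ scaled) (row (fin k) x) (row (fin k) (next k x))
        ≈⟨ ∂-cong (trans (t-scale k r f gen)
             (·-congˡ (trans (∘-congˡ (row-id (fin k))) (identityʳ _)))) refl refl ⟩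
      ∂ ((r ^ k) · t k f) (row (fin k) x) (row (fin k) (next k x))
        ≈⟨ trans (∘-congʳ (Hom.·-homo D-additive _ _)) (·-∘ _ _ _) ⟩
      (r ^ k) · ∂ (t k f) (row (fin k) x) (row (fin k) (next k x)) ∎

  -- Multiplication of a power series by its variable.
  shift : ∀ {W X} → (ℕ → W ⇒ X) → ℕ → W ⇒ X
  shift u zero    = 0⇒
  shift u (suc a) = u a

  coeff-∘-π₀ : ∀ {k W X a} → a ℕ.≤ k → (x : ℕ → W ⇒ X) (v : W ⇒ S (fin k) X) →
               (coeff (fin k) a ∘ π₀) ∘ ⟨ row (fin k) x , v ⟩ ≈ x a
  coeff-∘-π₀ {k} a≤k x v =
    trans (assoc _ _ _) (trans (∘-congˡ (π₀-pair _ _)) (coeff-row (fin k) a≤k x))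

  coeff-∘-π₁ : ∀ {k W X a} → a ℕ.≤ k → (x : ℕ → W ⇒ X) (v : W ⇒ S (fin k) X) →
               (coeff (fin k) a ∘ π₁) ∘ ⟨ v , row (fin k) x ⟩ ≈ x a
  coeff-∘-π₁ {k} a≤k x v =
    trans (assoc _ _ _) (trans (∘-congˡ (π₁-pair _ _)) (coeff-row (fin k) a≤k x))

  -- ∂t_{j+1}/∂x_{a+1} = ∂t_j/∂x_a
  ∂-t-shift : Cancellative C → ∀ j {W X Y} (g : X ⇒ Y) (x u : ℕ → W ⇒ X) →
              ∂ (t (suc j) g) (row (fin (suc j)) x) (row (fin (suc j)) (shift u)) ≈
              ∂ (t j g) (row (fin j) x) (row (fin j) u)
  ∂-t-shift cancel zero g x u = begin
    ∂ (t 1 g) (row (fin 1) x) (row (fin 1) (shift u))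
      ≈⟨ ∂-t-suc 0 g x (shift u) ⟩
    ∂ (D (t 0 g)) ⟨ row (fin 0) x , row (fin 0) (next 0 x) ⟩
                  ⟨ row (fin 0) (shift u) , row (fin 0) (next 0 (shift u)) ⟩
      ≈⟨ ∂∂-split (t 0 g) _ _ _ _ ⟩
    ∂ (D (t 0 g)) ⟨ row (fin 0) x , row (fin 0) (next 0 x) ⟩ ⟨ row (fin 0) (shift u) , 0⇒ ⟩
      + ∂ (t 0 g) (row (fin 0) x) (row (fin 0) (next 0 (shift u)))
      ≈⟨ +-cong (trans (∂-congˡ (D (t 0 g)) refl
                         (trans (pair-cong (row-0 (fin 0) λ { zero _ → refl }) refl) pair-0))
                       (∂-0 (D (t 0 g)) _))
                (∂-congˡ (t 0 g) refl (row-cong (fin 0) λ { zero _ →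
                  trans (·-congʳ (frac-self 1)) (·-identityˡ _) })) ⟩
    0⇒ + ∂ (t 0 g) (row (fin 0) x) (row (fin 0) u)
      ≈⟨ +-identityˡ _ ⟩
    ∂ (t 0 g) (row (fin 0) x) (row (fin 0) u) ∎
  ∂-t-shift cancel (suc i) {W} {X} g x u = trans expand (cancel Z _ _ cancelled)
    where
    k = suc i
    q = frac (suc i) (suc k)
    P = ∂ (D (t i g)) ⟨ row (fin i) x , row (fin i) (next i x) ⟩ ⟨ row (fin i) u , 0⇒ ⟩
    Q = ∂ (t k g) (row (fin k) x) (row (fin k) u)
    V = ∂ (t i g) (row (fin i) x) (row (fin i) (next i u))
    N = ∂ (t k g) (row (fin k) x) (row (fin k) (next k (shift u)))
    -- The goal is q · P + N ≈ Q, where Q ≈ P + V. One would like to write q · P as q · Q - q · V;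
    -- in place of the subtraction, Z ≈ q · V is added to both sides and cancelled afterwards.
    Z = ∂ (t k g) (row (fin k) x) (row (fin k) (λ a → frac a (suc k) · u a))

    genˣ genᵘ : ℕ → Sq (S (fin k) X) ⇒ X
    genˣ a = coeff (fin k) a ∘ π₀
    genᵘ a = coeff (fin k) a ∘ π₁

    linear-genˣ : ∀ a → Linear (genˣ a)
    linear-genˣ a = linear-∘ (linear-coeff k a) (linear-π 1 zero)

    linear-genᵘ : ∀ a → Linear (genᵘ a)
    linear-genᵘ a = linear-∘ (linear-coeff k a) (linear-π 1 (suc zero))

    linear-shift : ∀ a → Linear (shift genᵘ a)
    linear-shift zero    = linear-0
    linear-shift (suc a) = linear-genᵘ a

    shift-∘ : ∀ (v y : ℕ → W ⇒ X) a → a ℕ.≤ k →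
              shift genᵘ a ∘ ⟨ row (fin k) v , row (fin k) y ⟩ ≈ shift y a
    shift-∘ v y zero    _   = 0-∘ _
    shift-∘ v y (suc a) a≤k = coeff-∘-π₁ (ℕ.<⇒≤ a≤k) y _

    at : ∀ j → j ℕ.≤ k → (x u : ℕ → W ⇒ X) →
         ⟨ row (fin j) genˣ , row (fin j) genᵘ ⟩ ∘ ⟨ row (fin k) x , row (fin k) u ⟩ ≈
         ⟨ row (fin j) x , row (fin j) u ⟩
    at j j≤k x u = trans (pair-∘ _ _ _) (pair-cong
      (trans (row-∘ (fin j) _ _) (row-cong (fin j) λ a a≤j → coeff-∘-π₀ (ℕ.≤-trans a≤j j≤k) x _))
      (trans (row-∘ (fin j) _ _) (row-cong (fin j) λ a a≤j → coeff-∘-π₁ (ℕ.≤-trans a≤j j≤k) u _)))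

    shifted-at : (x u : ℕ → W ⇒ X) →
      ⟨ row (fin k) genˣ , row (fin k) (shift genᵘ) ⟩ ∘ ⟨ row (fin k) x , row (fin k) u ⟩ ≈
      ⟨ row (fin k) x , row (fin k) (shift u) ⟩
    shifted-at x u = trans (pair-∘ _ _ _) (pair-cong
      (trans (row-∘ (fin k) _ _) (row-cong (fin k) λ a a≤k → coeff-∘-π₀ a≤k x _))
      (trans (row-∘ (fin k) _ _) (row-cong (fin k) (shift-∘ x u))))

    zeros : ℕ → W ⇒ X
    zeros _ = 0⇒

    row-zeros : ∀ j → row (fin j) zeros ≈ 0⇒
    row-zeros j = row-0 (fin j) λ _ _ → refl

    shift-zeros : row (fin k) (shift zeros) ≈ 0⇒
    shift-zeros = row-0 (fin k) λ { zero _ → refl ; (suc _) _ → refl }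

    first : ∂ (D (t k g)) ⟨ row (fin k) x , row (fin k) (next k x) ⟩
                          ⟨ row (fin k) (shift u) , 0⇒ ⟩ ≈ q · P
    first = begin
      ∂ (D (t k g)) ⟨ row (fin k) x , row (fin k) (next k x) ⟩ ⟨ row (fin k) (shift u) , 0⇒ ⟩
        -- Symmetry carries the shift from the direction into the base point. The term becomes a
        -- derivative of the induction hypothesis, and a second use of symmetry at the end undoes
        -- the move.
        ≈⟨ D-symmetric (t k g) _ _ _ _ ⟩
      ∂ (D (t k g)) ⟨ row (fin k) x , row (fin k) (shift u) ⟩ ⟨ row (fin k) (next k x) , 0⇒ ⟩
        ≈⟨ ∂-transfer
             (linear-pair (linear-row k λ a _ → linear-genˣ a) (linear-row k λ a _ → linear-shift a))
             (linear-pair (linear-row i λ a _ → linear-genˣ a) (linear-row i λ a _ → linear-genᵘ a))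
             (∂-t-shift cancel i g genˣ genᵘ)
             ⟨ row (fin k) x , row (fin k) u ⟩ ⟨ row (fin k) (next k x) , row (fin k) zeros ⟩
             (shifted-at x u)
             (trans (shifted-at (next k x) zeros) (pair-cong refl shift-zeros))
             (at i (ℕ.n≤1+n i) x u)
             (trans (at i (ℕ.n≤1+n i) (next k x) zeros) (pair-cong refl (row-zeros i))) ⟩
      ∂ (D (t i g)) ⟨ row (fin i) x , row (fin i) u ⟩ ⟨ row (fin i) (next k x) , 0⇒ ⟩
        ≈⟨ ∂-congˡ (D (t i g)) refl (trans
             (pair-cong (trans (row-cong (fin i) λ a _ → sym (frac-next i k x a))
                               (sym (row-· (fin i) q _)))
                        (sym (·-zeroʳ q)))
             (sym (pair-· q _ _))) ⟩
      ∂ (D (t i g)) ⟨ row (fin i) x , row (fin i) u ⟩ (q · ⟨ row (fin i) (next i x) , 0⇒ ⟩)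
        ≈⟨ ∂-· (D (t i g)) _ q _ ⟩
      q · ∂ (D (t i g)) ⟨ row (fin i) x , row (fin i) u ⟩ ⟨ row (fin i) (next i x) , 0⇒ ⟩
        ≈⟨ ·-congˡ (D-symmetric (t i g) _ _ _ _) ⟩
      q · P ∎

    expand : ∂ (t (suc k) g) (row (fin (suc k)) x) (row (fin (suc k)) (shift u)) ≈ q · P + N
    expand = trans (∂-t-suc k g x (shift u)) (trans (∂∂-split (t k g) _ _ _ _) (+-cong first refl))

    Q≈ : Q ≈ P + V
    Q≈ = trans (∂-t-suc i g x u) (∂∂-split (t i g) _ _ _ _)

    Z≈ : Z ≈ q · V
    Z≈ = begin
      Z
        -- The weight a/(k + 1) vanishes at a = 0; therefore the direction of Z is q times a shift,
        -- to which the induction hypothesis applies.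
        ≈⟨ ∂-congˡ (t k g) refl (trans (row-· (fin k) q _) (row-cong (fin k) λ
             { zero    _ → trans (·-zeroʳ q) (sym (trans (·-congʳ (frac-0 (suc k))) (·-zeroˡ _)))
             ; (suc a) _ → frac-next i k u a })) ⟨
      ∂ (t k g) (row (fin k) x) (q · row (fin k) (shift (next i u)))
        ≈⟨ ∂-· (t k g) _ q _ ⟩
      q · ∂ (t k g) (row (fin k) x) (row (fin k) (shift (next i u)))
        ≈⟨ ·-congˡ (∂-t-shift cancel i g x (next i u)) ⟩
      q · V ∎

    coefficients : ∀ a → q · u a + next k (shift u) a ≈ frac a (suc k) · u a + u a
    coefficients a = begin
      q · u a + frac (suc a) (suc k) · u a
        ≈⟨ ·-distribʳ _ _ _ ⟨
      (q ⊕ frac (suc a) (suc k)) · u a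
        -- Comparison of numerators: (i + 1) + (a + 1) = a + (k + 1), because k = i + 1.
        ≈⟨ ·-congʳ (transᴷ (frac-+ (suc i) (suc a) (suc k)) (transᴷ
             (frac-cong (suc k) (≡.trans (ℕ.+-comm (suc i) (suc a)) (≡.sym (ℕ.+-suc a (suc i)))))
             (symᴷ (frac-+ a (suc k) (suc k))))) ⟩
      (frac a (suc k) ⊕ frac (suc k) (suc k)) · u a
        ≈⟨ ·-distribʳ _ _ _ ⟩
      frac a (suc k) · u a + frac (suc k) (suc k) · u a
        ≈⟨ +-congˡ (trans (·-congʳ (frac-self (suc k))) (·-identityˡ _)) ⟩
      frac a (suc k) · u a + u a ∎

    cancelled : Z + (q · P + N) ≈ Z + Q
    cancelled = begin
      Z + (q · P + N)         ≈⟨ +-assoc _ _ _ ⟨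
      Z + q · P + N           ≈⟨ +-congʳ (trans (+-congʳ Z≈) (+-comm _ _)) ⟩
      q · P + q · V + N       ≈⟨ +-congʳ (trans (sym (·-distribˡ q P V)) (·-congˡ (sym Q≈))) ⟩
      q · Q + N               ≈⟨ +-congʳ (∂-· (t k g) _ q _) ⟨
      ∂ (t k g) (row (fin k) x) (q · row (fin k) u) + N
                              ≈⟨ ∂-+ (t k g) _ _ _ ⟨
      ∂ (t k g) (row (fin k) x) (q · row (fin k) u + row (fin k) (next k (shift u)))
        ≈⟨ ∂-congˡ (t k g) refl (trans (+-congʳ (row-· (fin k) q u)) (trans (row-+ (fin k) _ _)
             (trans (row-cong (fin k) λ a _ → coefficients a) (sym (row-+ (fin k) _ _))))) ⟩
      ∂ (t k g) (row (fin k) x) (row (fin k) (λ a → frac a (suc k) · u a) + row (fin k) u)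
                              ≈⟨ ∂-+ (t k g) _ _ _ ⟩
      Z + Q                   ∎

  -- Two differentiations commute. In the inductive step both sides are derivatives of `D (t j g)`
  -- that differ only in which of u and `next j x` belongs to the base point and which to the
  -- direction; `D-symmetric` interchanges the two.
  t-D : ∀ j {W X Y} (g : X ⇒ Y) (x u : ℕ → W ⇒ X) →
        t j (D g) ∘ row (fin j) (λ b → ⟨ x b , u b ⟩) ≈ ∂ (t j g) (row (fin j) x) (row (fin j) u)
  t-D zero g x u = begin
    t 0 (D g) ∘ row (fin 0) (λ b → ⟨ x b , u b ⟩)
      ≈⟨ t-zero-row (D g) _ ⟩
    ∂ g (x 0) (u 0)
      ≈⟨ ∂-congˡ g (π-row₀ x) (π-row₀ u) ⟨
    ∂ g (π (fin 0) zero ∘ row (fin 0) x) (π (fin 0) zero ∘ row (fin 0) u)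
      ≈⟨ ∂-∘-linear g (linear-π 0 zero) _ _ ⟨
    ∂ (t 0 g) (row (fin 0) x) (row (fin 0) u) ∎
  t-D (suc j) {W} {X} g x u = begin
    t (suc j) (D g) ∘ row (fin (suc j)) xu
      ≈⟨ t-suc-row j (D g) xu ⟩
    ∂ (t j (D g)) (row (fin j) xu) (row (fin j) (next j xu))
      ≈⟨ ∂-transfer linear-id
           (linear-pair (linear-row j λ a _ → linear-∘ (linear-π 1 zero) (linear-coeff j a))
                        (linear-row j λ a _ → linear-∘ (linear-π 1 (suc zero)) (linear-coeff j a)))
           generic (row (fin j) xu) (row (fin j) (next j xu))
           (identityˡ _) (identityˡ _) (unzip x u)
           (trans (∘-congˡ (row-cong (fin j) λ a _ → pair-· _ _ _)) (unzip (next j x) (next j u))) ⟩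
    ∂ (D (t j g)) ⟨ row (fin j) x , row (fin j) u ⟩ ⟨ row (fin j) (next j x) , row (fin j) (next j u) ⟩
      ≈⟨ D-symmetric (t j g) _ _ _ _ ⟩
    ∂ (D (t j g)) ⟨ row (fin j) x , row (fin j) (next j x) ⟩ ⟨ row (fin j) u , row (fin j) (next j u) ⟩
      ≈⟨ ∂-t-suc j g x u ⟨
    ∂ (t (suc j) g) (row (fin (suc j)) x) (row (fin (suc j)) u) ∎
    where
    xu : ℕ → W ⇒ Sq X
    xu b = ⟨ x b , u b ⟩

    gen₀ gen₁ : ℕ → S (fin j) (Sq X) ⇒ X
    gen₀ a = π₀ ∘ coeff (fin j) a
    gen₁ a = π₁ ∘ coeff (fin j) a

    generic : t j (D g) ∘ id ≈ D (t j g) ∘ ⟨ row (fin j) gen₀ , row (fin j) gen₁ ⟩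
    generic = trans
      (∘-congˡ (sym (trans (row-cong (fin j) λ a _ → pair-η _) (row-id (fin j)))))
      (t-D j g gen₀ gen₁)

    unzip : (x u : ℕ → W ⇒ X) →
            ⟨ row (fin j) gen₀ , row (fin j) gen₁ ⟩ ∘ row (fin j) (λ b → ⟨ x b , u b ⟩) ≈
            ⟨ row (fin j) x , row (fin j) u ⟩
    unzip x u = trans (pair-∘ _ _ _) (pair-cong
      (trans (row-∘ (fin j) _ _) (row-cong (fin j) λ a a≤j →
        trans (assoc _ _ _) (trans (∘-congˡ (coeff-row (fin j) a≤j _)) (π₀-pair _ _))))
      (trans (row-∘ (fin j) _ _) (row-cong (fin j) λ a a≤j →
        trans (assoc _ _ _) (trans (∘-congˡ (coeff-row (fin j) a≤j _)) (π₁-pair _ _)))))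

  -- Iterated coefficients on rectangular arrays

  grid : ∀ j i {W X} → (ℕ → ℕ → W ⇒ X) → W ⇒ S (fin j) (S (fin i) X)
  grid j i x = row (fin j) (λ b → row (fin i) (x b))

  grid-cong : ∀ j i {W X} {x y : ℕ → ℕ → W ⇒ X} →
              (∀ b a → b ℕ.≤ j → a ℕ.≤ i → x b a ≈ y b a) → grid j i x ≈ grid j i y
  grid-cong j i x≈y = row-cong (fin j) λ b b≤j → row-cong (fin i) λ a a≤i → x≈y b a b≤j a≤i

  grid-∘ : ∀ j i {V W X} (x : ℕ → ℕ → W ⇒ X) (h : V ⇒ W) →
           grid j i x ∘ h ≈ grid j i (λ b a → x b a ∘ h)
  grid-∘ j i x h = trans (row-∘ (fin j) _ h) (row-cong (fin j) λ b _ → row-∘ (fin i) _ h)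

  linear-grid : ∀ j i {W X} {x : ℕ → ℕ → W ⇒ X} → (∀ b a → Linear (x b a)) → Linear (grid j i x)
  linear-grid j i x-linear = linear-row j λ b _ → linear-row i λ a _ → x-linear b a

  -- The generic array, at which identities about arrays are differentiated.
  gen₂ : ∀ k l {X} → ℕ → ℕ → S (fin k) (S (fin l) X) ⇒ X
  gen₂ k l b a = coeff (fin l) a ∘ coeff (fin k) b

  linear-gen₂ : ∀ k l {X} b a → Linear (gen₂ k l {X} b a)
  linear-gen₂ k l b a = linear-∘ (linear-coeff l a) (linear-coeff k b)

  gen₂-grid : ∀ k l {b a W X} → b ℕ.≤ k → a ℕ.≤ l → (x : ℕ → ℕ → W ⇒ X) →
              gen₂ k l b a ∘ grid k l x ≈ x b a
  gen₂-grid k l b≤k a≤l x = trans (assoc _ _ _)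
    (trans (∘-congˡ (coeff-row (fin k) b≤k _)) (coeff-row (fin l) a≤l (x _)))

  grid-gen₂ : ∀ k l {X} → grid k l (gen₂ k l {X}) ≈ id
  grid-gen₂ k l = trans (row-cong (fin k) λ b _ → row-coeff (fin l) _) (row-id (fin k))

  tt-zero-grid : ∀ j {W X Y} (f : X ⇒ Y) (x : ℕ → ℕ → W ⇒ X) →
                 t j (t 0 f) ∘ grid j 0 x ≈ t j f ∘ row (fin j) (λ b → x b 0)
  tt-zero-grid j f x = trans (t-∘-linear-row j f (linear-π 0 zero) _)
    (∘-congˡ (row-cong (fin j) λ b _ → π-row₀ (x b)))

  -- Since `t j` commutes with D by `t-D`, raising the inner order means differentiating along the
  -- inner direction. Raising the outer order means differentiating along the outer one
  -- (`t-suc-row`). The naturality of exchange, lift and θ is derived from these two recursions.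
  tt-suc-grid : ∀ j i {W X Y} (f : X ⇒ Y) (x : ℕ → ℕ → W ⇒ X) →
                t j (t (suc i) f) ∘ grid j (suc i) x ≈
                ∂ (t j (t i f)) (grid j i x) (grid j i (λ b → next i (x b)))
  tt-suc-grid j i f x = trans (t-∘-linear-row j (D (t i f)) (linear-ν i) _)
    (trans (∘-congˡ (row-cong (fin j) λ b _ → ν-row i (x b))) (t-D j (t i f) _ _))

  -- Induction on i, which is the inner order on the left and the outer order on the right. The two
  -- recursions differentiate both sides along the same direction, up to transposition.
  t-exchange : ∀ j i {W X Y} (f : X ⇒ Y) (x : ℕ → ℕ → W ⇒ X) →
               t j (t i f) ∘ grid j i x ≈ t i (t j f) ∘ grid i j (λ a b → x b a)
  t-exchange j zero    f x = trans (tt-zero-grid j f x) (sym (t-zero-row (t j f) _))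
  t-exchange j (suc i) f x = begin
    t j (t (suc i) f) ∘ grid j (suc i) x
      ≈⟨ tt-suc-grid j i f x ⟩
    ∂ (t j (t i f)) (grid j i x) (grid j i (λ b → next i (x b)))
      ≈⟨ ∂-transfer linear-id (linear-grid i j λ a b → linear-gen₂ j i b a)
           (trans (∘-congˡ (sym (grid-gen₂ j i))) (t-exchange j i f (gen₂ j i)))
           (grid j i x) (grid j i (λ b → next i (x b)))
           (identityˡ _) (identityˡ _) (transpose x) (transpose (λ b → next i (x b))) ⟩
    ∂ (t i (t j f)) (grid i j (λ a b → x b a)) (grid i j (λ a b → next i (x b) a))
      ≈⟨ ∂-congˡ _ refl (row-cong (fin i) λ a _ → row-· (fin j) _ _) ⟨
    ∂ (t i (t j f)) (grid i j (λ a b → x b a)) (row (fin i) (next i λ a → row (fin j) λ b → x b a))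
      ≈⟨ t-suc-row i (t j f) _ ⟨
    t (suc i) (t j f) ∘ grid (suc i) j (λ a b → x b a) ∎
    where
    transpose : ∀ y → grid i j (λ a b → gen₂ j i b a) ∘ grid j i y ≈ grid i j (λ a b → y b a)
    transpose y = trans (grid-∘ i j _ _)
      (grid-cong i j λ a b a≤i b≤j → gen₂-grid j i b≤j a≤i y)

  when-zero-sym : ∀ {X Y} (f : X ⇒ Y) b → f when (0 ℕ.≟ b) ≈ f when (b ℕ.≟ 0)
  when-zero-sym f zero    = refl
  when-zero-sym f (suc b) = refl

  t-lift : Cancellative C → ∀ j i {W X Y} (f : X ⇒ Y) (x : ℕ → W ⇒ X) →
           t j (t i f) ∘ grid j i (λ b a → x a when (a ℕ.≟ b)) ≈
           (t i f ∘ row (fin i) x) when (i ℕ.≟ j)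
  t-lift cancel j zero f x = begin
    t j (t 0 f) ∘ grid j 0 (λ b a → x a when (a ℕ.≟ b))
      ≈⟨ tt-zero-grid j f _ ⟩
    t j f ∘ row (fin j) (λ b → x 0 when (0 ℕ.≟ b))
      ≈⟨ ∘-congˡ (row-cong (fin j) λ b _ → when-zero-sym (x 0) b) ⟩
    t j f ∘ row (fin j) (λ b → x 0 when (b ℕ.≟ 0))
      ≈⟨ t-constant j f (x 0) ⟩
    (f ∘ x 0) when (j ℕ.≟ 0)
      ≈⟨ when-zero-sym _ j ⟨
    (f ∘ x 0) when (0 ℕ.≟ j)
      ≈⟨ when-cong (0 ℕ.≟ j) (t-zero-row f x) ⟨
    (t 0 f ∘ row (fin 0) x) when (0 ℕ.≟ j) ∎
  t-lift cancel zero (suc i) f x = trans (tt-suc-grid 0 i f _)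
    (trans (∂-congˡ _ refl (row-0 (fin 0) λ { zero _ → row-0 (fin i) λ a _ → ·-zeroʳ _ }))
           (∂-0 _ _))
  t-lift cancel (suc j) (suc i) {X = X} f x = begin
    t (suc j) (t (suc i) f) ∘ grid (suc j) (suc i) (diagonal x)
      ≈⟨ tt-suc-grid (suc j) i f _ ⟩
    ∂ (t (suc j) (t i f)) (grid (suc j) i (diagonal x))
                          (grid (suc j) i (λ b → next i (diagonal x b)))
      -- Row 0 of the direction vanishes, since a + 1 is never 0, and in row b + 1 the condition a +
      -- 1 = b + 1 amounts to a = b. So the direction is a diagonal array moved down by one row, and
      -- `∂-t-shift` lowers the outer order together with the inner one.
      ≈⟨ ∂-congˡ _ refl (row-cong (fin (suc j)) λ
           { zero    _ → row-0 (fin i) λ a _ → ·-zeroʳ _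
           ; (suc b) _ → row-cong (fin i) λ a _ →
               when-homo {φ = frac (suc a) (suc i) ·_} (·-zeroʳ _) (x (suc a)) (a ℕ.≟ b) }) ⟩
    ∂ (t (suc j) (t i f)) (grid (suc j) i (diagonal x))
                          (row (fin (suc j)) (shift (λ b → row (fin i) (diagonal (next i x) b))))
      ≈⟨ ∂-t-shift cancel j (t i f) _ _ ⟩
    ∂ (t j (t i f)) (grid j i (diagonal x)) (grid j i (diagonal (next i x)))
      ≈⟨ ∂-transfer
           (linear-grid j i λ b a → linear-when a b)
           linear-id
           (trans (t-lift cancel j i f (coeff (fin i))) (trans
             (when-cong (i ℕ.≟ j) (trans (∘-congˡ (row-id (fin i))) (identityʳ _))) (sym (identityʳ _))))
           (row (fin i) x) (row (fin i) (next i x))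
           (diagonal-row x) (diagonal-row (next i x)) (identityˡ _) (identityˡ _) ⟩
    ∂ (t i f when (i ℕ.≟ j)) (row (fin i) x) (row (fin i) (next i x))
      ≈⟨ trans (∘-congʳ (D-when (t i f) (i ℕ.≟ j))) (when-∘ (D (t i f)) (i ℕ.≟ j) _) ⟩
    ∂ (t i f) (row (fin i) x) (row (fin i) (next i x)) when (i ℕ.≟ j)
      ≈⟨ when-cong (i ℕ.≟ j) (t-suc-row i f x) ⟨
    (t (suc i) f ∘ row (fin (suc i)) x) when (i ℕ.≟ j) ∎
    where
    diagonal : ∀ {V} → (ℕ → V ⇒ X) → ℕ → ℕ → V ⇒ X
    diagonal x b a = x a when (a ℕ.≟ b)

    linear-when : ∀ a b → Linear (diagonal (coeff (fin i)) b a)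
    linear-when a b = trans (D-when _ (a ℕ.≟ b))
      (trans (when-cong (a ℕ.≟ b) (linear-coeff i a)) (sym (when-∘ _ (a ℕ.≟ b) _)))

    diagonal-row : ∀ {V} (y : ℕ → V ⇒ X) →
                   grid j i (diagonal (coeff (fin i))) ∘ row (fin i) y ≈ grid j i (diagonal y)
    diagonal-row y = trans (grid-∘ j i _ _) (grid-cong j i λ b a _ a≤i →
      trans (when-∘ _ (a ℕ.≟ b) _) (when-cong (a ℕ.≟ b) (coeff-row (fin i) a≤i y)))

  -- Euler's identity is used twice. Applied to the arguments, it turns the direction of
  -- `t (suc k) f` into the antidiagonal sums of `y`, so the induction hypothesis can be
  -- differentiated along `y`. Applied to the values, it collects the resulting terms into k + 1
  -- times the sum of degree k + 1, and k + 1 is divided out.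
  t-θ : ∀ k {W X Y} (f : X ⇒ Y) (x : ℕ → ℕ → W ⇒ X) →
        t k f ∘ row (fin k) (λ a → conv a (λ i j → x j i)) ≈
        conv k (λ i j → t j (t i f) ∘ grid j i x)
  t-θ zero    f x = trans (t-zero-row f _)
    (sym (trans (tt-zero-grid 0 f x) (t-zero-row f _)))
  t-θ (suc k) {W} {X} {Y} f x = begin
    t (suc k) f ∘ row (fin (suc k)) (total x)
      ≈⟨ t-suc-row k f (total x) ⟩
    ∂ (t k f) (row (fin k) (total x)) (row (fin k) (next k (total x)))
      ≈⟨ ∂-congˡ _ refl (trans (row-cong (fin k) λ a _ → next-total a) (sym (row-· (fin k) _ _))) ⟩
    ∂ (t k f) (row (fin k) (total x)) (r · row (fin k) (total y))
      ≈⟨ ∂-· _ _ r _ ⟩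
    r · ∂ (t k f) (row (fin k) (total x)) (row (fin k) (total y))
      ≈⟨ ·-congˡ (∂-transfer
           (linear-row k λ a _ → linear-total a) linear-id
           (trans (t-θ k f (gen₂ k k)) (sym (identityʳ _)))
           (grid k k x) (grid k k y)
           (total-grid x) (total-grid y) (identityˡ _) (identityˡ _)) ⟩
    r · ∂ (conv k (λ i j → t j (t i f) ∘ grid j i (gen₂ k k))) (grid k k x) (grid k k y)
      ≈⟨ ·-congˡ (trans (∘-congʳ (conv-additive D-additive k _)) (conv-∘ k _ _)) ⟩
    r · conv k (λ i j → ∂ (t j (t i f) ∘ grid j i (gen₂ k k)) (grid k k x) (grid k k y))
      ≈⟨ ·-congˡ (conv-cong k summand) ⟩
    r · conv k (λ i j → nat (suc i) · F (suc i) j + nat (suc j) · F i (suc j))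
      ≈⟨ ·-congˡ (conv-euler k F) ⟨
    r · nat (suc k) · conv (suc k) F
      ≈⟨ ·-invert k _ ⟩
    conv (suc k) F ∎
    where
    r = 1/ suc k

    F : ℕ → ℕ → W ⇒ Y
    F i j = t j (t i f) ∘ grid j i x

    total : ∀ {V} → (ℕ → ℕ → V ⇒ X) → ℕ → V ⇒ X
    total x a = conv a (λ i j → x j i)

    -- For a series in two variables, the sum of its two formal partial derivatives.
    y : ℕ → ℕ → W ⇒ X
    y b a = nat (suc a) · x b (suc a) + nat (suc b) · x (suc b) a

    next-total : ∀ a → next k (total x) a ≈ r · total y a
    next-total a = begin
      (nat (suc a) ⊗ r) · total x (suc a) ≈⟨ ·-congʳ (*-comm _ _) ⟩
      (r ⊗ nat (suc a)) · total x (suc a) ≈⟨ ·-assoc _ _ _ ⟩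
      r · nat (suc a) · total x (suc a)   ≈⟨ ·-congˡ (conv-euler a λ i j → x j i) ⟩
      r · total y a                       ∎

    linear-conv : ∀ a {V Z} {G : ℕ → ℕ → V ⇒ Z} → (∀ i j → Linear (G i j)) → Linear (conv a G)
    linear-conv zero    G-linear = G-linear 0 0
    linear-conv (suc a) G-linear = linear-+ (G-linear 0 (suc a)) (linear-conv a λ i → G-linear (suc i))

    linear-total : ∀ a → Linear (total (gen₂ k k) a)
    linear-total a = linear-conv a λ i j → linear-gen₂ k k j i

    total-grid : ∀ x → row (fin k) (total (gen₂ k k)) ∘ grid k k x ≈ row (fin k) (total x)
    total-grid x = trans (row-∘ (fin k) _ _) (row-cong (fin k) λ a a≤k →
      trans (conv-∘ a _ _) (conv-cong a λ i j e → gen₂-grid k k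
        (ℕ.≤-trans (ℕ.m+n≤o⇒n≤o i (ℕ.≤-reflexive e)) a≤k)
        (ℕ.≤-trans (ℕ.m+n≤o⇒m≤o i (ℕ.≤-reflexive e)) a≤k) x))

    nat-next : ∀ i {V} (z : ℕ → V ⇒ X) a → nat (suc i) · next i z a ≈ nat (suc a) · z (suc a)
    nat-next i z a = trans (sym (·-assoc _ _ _)) (·-congʳ (*-frac (suc a) (suc i)))

    -- The factors i + 1 and j + 1 clear the denominators of the inner and the outer direction; they
    -- are the weights that Euler's identity requires.
    grid-y : ∀ i j → grid j i y ≈ nat (suc i) · grid j i (λ b → next i (x b))
                                + nat (suc j) · row (fin j) (next j (λ b → row (fin i) (x b)))
    grid-y i j = sym (trans
      (+-cong (row-· (fin j) _ _) (row-· (fin j) _ _))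
      (trans (row-+ (fin j) _ _) (row-cong (fin j) λ b _ → trans
        (+-cong (trans (row-· (fin i) _ _) (row-cong (fin i) λ a _ → nat-next i (x b) a))
                (trans (sym (·-assoc _ _ _))
                  (trans (·-congʳ (*-frac (suc b) (suc j))) (row-· (fin i) _ _))))
        (row-+ (fin i) _ _))))

    summand : ∀ i j → i ℕ.+ j ≡ k →
      ∂ (t j (t i f) ∘ grid j i (gen₂ k k)) (grid k k x) (grid k k y) ≈
      nat (suc i) · F (suc i) j + nat (suc j) · F i (suc j)
    summand i j e = begin
      ∂ (t j (t i f) ∘ grid j i (gen₂ k k)) (grid k k x) (grid k k y)
        ≈⟨ ∂-∘-linear _ (linear-grid j i λ b a → linear-gen₂ k k b a) _ _ ⟩
      ∂ (t j (t i f)) (grid j i (gen₂ k k) ∘ grid k k x) (grid j i (gen₂ k k) ∘ grid k k y)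
        ≈⟨ ∂-congˡ _ (truncate x) (trans (truncate y) (grid-y i j)) ⟩
      ∂ (t j (t i f)) (grid j i x)
        (nat (suc i) · grid j i (λ b → next i (x b))
          + nat (suc j) · row (fin j) (next j (λ b → row (fin i) (x b))))
        ≈⟨ trans (∂-+ _ _ _ _) (+-cong (∂-· _ _ _ _) (∂-· _ _ _ _)) ⟩
      nat (suc i) · ∂ (t j (t i f)) (grid j i x) (grid j i (λ b → next i (x b)))
        + nat (suc j) · ∂ (t j (t i f)) (grid j i x) (row (fin j) (next j (λ b → row (fin i) (x b))))
        ≈⟨ +-cong (·-congˡ (tt-suc-grid j i f x)) (·-congˡ (t-suc-row j (t i f) _)) ⟨
      nat (suc i) · F (suc i) j + nat (suc j) · F i (suc j) ∎
      where
      truncate : ∀ x → grid j i (gen₂ k k) ∘ grid k k x ≈ grid j i x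
      truncate x = trans (grid-∘ j i _ _) (grid-cong j i λ b a b≤j a≤i → gen₂-grid k k
        (ℕ.≤-trans b≤j (ℕ.m+n≤o⇒n≤o i (ℕ.≤-reflexive e)))
        (ℕ.≤-trans a≤i (ℕ.m+n≤o⇒m≤o i (ℕ.≤-reflexive e))) x)

-- The Taylor expansion of a derivative

module FromDerivative
  {c ℓr o m ℓ : Level} {R : CommutativeSemiring c ℓr} (inverses : IntegerInverses R)
  {C : CartesianLeftAdditiveCategory R o m ℓ} (cancel : Cancellative C)
  {n : Order C} (d : Differential.Derivative C n) where
  open CartesianLeftAdditiveCategory C
  open LeftAdditive leftAdditiveCategory
  open Differential C hiding (t; T)
  open Powers C
  open Derivative d
  open DerivativeProperties d
  open TaylorCoefficients inverses d

  T : ∀ {X Y} → X ⇒ Y → S n X ⇒ S n Y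
  T = Differential.T C inverses d

  linear-coeffₙ : ∀ {X} a → a ≤ω n → Linear (coeff n {X} a)
  linear-coeffₙ a a≤n = linear-cong (sym (coeff-π n a≤n)) (D-projection (isProjection n _))

  T≈row : ∀ {X Y} (f : X ⇒ Y) → T f ≈ row n (λ k → t k f ∘ row (fin k) (coeff n))
  T≈row f = tuple≈row n _ λ k → ∘-congˡ (s≈row n (deg≤ n k))

  T-row : ∀ {W X Y} (f : X ⇒ Y) (x : ℕ → W ⇒ X) →
          T f ∘ row n x ≈ row n (λ k → t k f ∘ row (fin k) x)
  T-row f x = trans (∘-congʳ (T≈row f)) (trans (row-∘ n _ _) (row-cong n λ k k≤n →
    trans (assoc _ _ _) (∘-congˡ (restrict n k≤n x))))

  -- The projection to degree i is linear, so it passes through the outer `t j` and turns `T f` into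
  -- `t i f`.
  TT-row₂ : ∀ {W X Y} (f : X ⇒ Y) (x : ℕ → ℕ → W ⇒ X) →
            T (T f) ∘ row₂ n x ≈ row₂ n (λ j i → t j (t i f) ∘ grid j i x)
  TT-row₂ f x = trans (T-row (T f) _) (row-cong n λ j j≤n → row-unique n λ i i≤n → begin
    coeff n i ∘ (t j (T f) ∘ row (fin j) (λ b → row n (x b)))
      ≈⟨ assoc _ _ _ ⟨
    (coeff n i ∘ t j (T f)) ∘ row (fin j) (λ b → row n (x b))
      ≈⟨ ∘-congʳ (t-linear-∘ j (linear-coeffₙ i i≤n) (T f)) ⟨
    t j (coeff n i ∘ T f) ∘ row (fin j) (λ b → row n (x b))
      ≈⟨ ∘-congʳ (t-cong j (trans (∘-congˡ (T≈row f)) (coeff-row n i≤n _))) ⟩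
    t j (t i f ∘ row (fin i) (coeff n)) ∘ row (fin j) (λ b → row n (x b))
      ≈⟨ t-∘-linear-row j (t i f)
           (linear-row i λ a a≤i → linear-coeffₙ a (≤ω-trans n a≤i i≤n)) _ ⟩
    t j (t i f) ∘ row (fin j) (λ b → row (fin i) (coeff n) ∘ row n (x b))
      ≈⟨ ∘-congˡ (row-cong (fin j) λ b _ → restrict n i≤n (x b)) ⟩
    t j (t i f) ∘ grid j i x ∎)

  T-linear : ∀ {X Y} {h : X ⇒ Y} → Linear h → T h ≈ S-map n h
  T-linear h-linear = trans (T≈row _) (trans
    (row-cong n λ k k≤n → trans (∘-congʳ (t-linear k h-linear))
      (trans (assoc _ _ _) (∘-congˡ (coeff-row (fin k) ℕ.≤-refl _))))
    (sym (S-map≈row n _)))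

  functor : Endofunctor category (S n)
  functor = record
    { F₁       = T
    ; F-cong   = λ f≈g → trans (T≈row _) (trans
        (row-cong n λ k _ → ∘-congʳ (t-cong k f≈g)) (sym (T≈row _)))
    ; identity = trans (T-linear linear-id) (trans (S-map≈row n id)
        (trans (row-cong n λ _ _ → identityˡ _) (row-id n)))
    ; compose  = λ g f → begin
        T (g ∘ f)
          ≈⟨ T≈row (g ∘ f) ⟩
        row n (λ k → t k (g ∘ f) ∘ row (fin k) (coeff n))
          ≈⟨ row-cong n (λ k k≤n → trans (∘-congʳ (t-∘ k g f)) (trans (assoc _ _ _)
               (∘-congˡ (trans (row-∘ (fin k) _ _) (row-cong (fin k) λ j j≤k →
                 trans (assoc _ _ _) (∘-congˡ (restrict (fin k) j≤k (coeff n)))))))) ⟩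
        row n (λ k → t k g ∘ row (fin k) (λ j → t j f ∘ row (fin j) (coeff n)))
          ≈⟨ T-row g _ ⟨
        T g ∘ row n (λ j → t j f ∘ row (fin j) (coeff n))
          ≈⟨ ∘-congˡ (T≈row f) ⟨
        T g ∘ T f ∎
    }

  row₂-id : ∀ {X} → row₂ n (λ b a → coeff n {X} a ∘ coeff n b) ≈ id
  row₂-id = trans (row-cong n λ b _ → row-coeff n (coeff n b)) (row-id n)

  at-generic : ∀ {X Y} {g h : S n X ⇒ Y} → g ∘ row n (coeff n) ≈ h ∘ row n (coeff n) → g ≈ h
  at-generic {g = g} {h} g≈h = trans (sym (identityʳ g)) (trans (∘-congˡ (sym (row-id n)))
    (trans g≈h (trans (∘-congˡ (row-id n)) (identityʳ h))))

  -- The identity of a double power is itself an array, so naturality squares need only be compared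
  -- on arrays.
  at-generic₂ : ∀ {X Y} {g h : S n (S n X) ⇒ Y} →
                (∀ {W} (x : ℕ → ℕ → W ⇒ X) → g ∘ row₂ n x ≈ h ∘ row₂ n x) → g ≈ h
  at-generic₂ {g = g} {h} g≈h = trans (sym (identityʳ g)) (trans (∘-congˡ (sym row₂-id))
    (trans (g≈h _) (trans (∘-congˡ row₂-id) (identityʳ h))))

  taylor : TaylorExpansion n
  taylor = record
    { functor          = functor
    ; U-projection     = λ p → T-linear (D-projection p)
    ; U-+              = T-linear (linear-+ (linear-π 1 zero) (linear-π 1 (suc zero)))
    ; U-·              = λ r → T-linear (linear-· r linear-id)
    ; π₀-natural       = λ f → begin
        π n (ix₀ n) ∘ T f                         ≈⟨ ∘-cong (π-ix₀ n) (T≈row f) ⟩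
        coeff n 0 ∘ row n (λ k → t k f ∘ row (fin k) (coeff n))
                                                  ≈⟨ coeff-row n (0≤ω n) _ ⟩
        t 0 f ∘ row (fin 0) (coeff n)             ≈⟨ t-zero-row f _ ⟩
        f ∘ coeff n 0                             ≈⟨ ∘-congˡ (π-ix₀ n) ⟨
        f ∘ π n (ix₀ n)                           ∎
    ; ι-natural        = λ f → begin
        ι n ∘ f
          ≈⟨ ι-∘ n f ⟩
        row n (λ a → f when (a ℕ.≟ 0))
          ≈⟨ row-cong n (λ k _ → trans (t-constant k f id) (when-cong (k ℕ.≟ 0) (identityʳ f))) ⟨
        row n (λ k → t k f ∘ row (fin k) (λ a → id when (a ℕ.≟ 0)))
          ≈⟨ T-row f _ ⟨
        T f ∘ row n (λ a → id when (a ℕ.≟ 0))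
          ≈⟨ ∘-congˡ (trans (sym (ι-∘ n id)) (identityʳ _)) ⟩
        T f ∘ ι n ∎
    ; θ-natural        = λ f → at-generic₂ λ x → begin
        (θ n ∘ T (T f)) ∘ row₂ n x
          ≈⟨ trans (assoc _ _ _) (∘-congˡ (TT-row₂ f x)) ⟩
        θ n ∘ row₂ n (λ j i → t j (t i f) ∘ grid j i x)
          ≈⟨ θ-∘ n _ ⟩
        row n (λ k → conv k (λ i j → t j (t i f) ∘ grid j i x))
          ≈⟨ row-cong n (λ k _ → t-θ k f x) ⟨
        row n (λ k → t k f ∘ row (fin k) (λ a → conv a (λ i j → x j i)))
          ≈⟨ T-row f _ ⟨
        T f ∘ row n (λ a → conv a (λ i j → x j i))
          ≈⟨ trans (∘-congˡ (sym (θ-∘ n x))) (sym (assoc _ _ _)) ⟩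
        (T f ∘ θ n) ∘ row₂ n x ∎
    ; scale-natural    = λ r f → at-generic (begin
        (scale n r ∘ T f) ∘ row n (coeff n)
          ≈⟨ trans (assoc _ _ _) (∘-congˡ (T-row f _)) ⟩
        scale n r ∘ row n (λ k → t k f ∘ row (fin k) (coeff n))
          ≈⟨ scale-∘ n r _ ⟩
        row n _
          ≈⟨ row-cong n (λ k _ → t-scale k r f (coeff n)) ⟨
        row n (λ k → t k f ∘ row (fin k) _)
          ≈⟨ T-row f _ ⟨
        T f ∘ row n _
          ≈⟨ trans (∘-congˡ (sym (scale-∘ n r _))) (sym (assoc _ _ _)) ⟩
        (T f ∘ scale n r) ∘ row n (coeff n) ∎)
    ; exchange-natural = λ f → at-generic₂ λ x → begin
        (exchange n ∘ T (T f)) ∘ row₂ n x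
          ≈⟨ trans (assoc _ _ _) (∘-congˡ (TT-row₂ f x)) ⟩
        exchange n ∘ row₂ n (λ j i → t j (t i f) ∘ grid j i x)
          ≈⟨ exchange-∘ n _ ⟩
        row₂ n (λ i j → t j (t i f) ∘ grid j i x)
          ≈⟨ row-cong n (λ i _ → row-cong n λ j _ → t-exchange j i f x) ⟩
        row₂ n (λ i j → t i (t j f) ∘ grid i j (λ a b → x b a))
          ≈⟨ TT-row₂ f _ ⟨
        T (T f) ∘ row₂ n (λ a b → x b a)
          ≈⟨ trans (∘-congˡ (sym (exchange-∘ n x))) (sym (assoc _ _ _)) ⟩
        (T (T f) ∘ exchange n) ∘ row₂ n x ∎
    ; lift-natural     = λ f → at-generic (begin
        (lift n ∘ T f) ∘ row n (coeff n)
          ≈⟨ trans (assoc _ _ _) (∘-congˡ (T-row f _)) ⟩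
        lift n ∘ row n (λ k → t k f ∘ row (fin k) (coeff n))
          ≈⟨ lift-∘ n _ ⟩
        row₂ n (λ j i → (t i f ∘ row (fin i) (coeff n)) when (i ℕ.≟ j))
          ≈⟨ row-cong n (λ j _ → row-cong n λ i _ → t-lift cancel j i f (coeff n)) ⟨
        row₂ n (λ j i → t j (t i f) ∘ grid j i (λ b a → coeff n a when (a ℕ.≟ b)))
          ≈⟨ TT-row₂ f _ ⟨
        T (T f) ∘ row₂ n (λ b a → coeff n a when (a ℕ.≟ b))
          ≈⟨ trans (∘-congˡ (sym (lift-∘ n _))) (sym (assoc _ _ _)) ⟩
        (T (T f) ∘ lift n) ∘ row n (coeff n) ∎)
    }

  u₁-taylor : ∀ 1≤n {X Y} (f : X ⇒ Y) → u₁ 1≤n taylor f ≈ D f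
  u₁-taylor 1≤n f = begin
    π n (ix₁ n 1≤n) ∘ (T f ∘ z 1 n)
      ≈⟨ ∘-cong (sym (coeff-embed n 1≤n (suc zero))) (trans (∘-congˡ (z≈row 1 n)) (T-row f _)) ⟩
    coeff n 1 ∘ row n (λ k → t k f ∘ row (fin k) (coeff (fin 1)))
      ≈⟨ coeff-row n 1≤n _ ⟩
    t 1 f ∘ row (fin 1) (coeff (fin 1))
      ≈⟨ t-suc-row 0 f _ ⟩
    ∂ (f ∘ π (fin 0) zero) (row (fin 0) (coeff (fin 1))) (row (fin 0) (next 0 (coeff (fin 1))))
      ≈⟨ ∂-∘-linear f (linear-π 0 zero) _ _ ⟩
    ∂ f (π (fin 0) zero ∘ row (fin 0) (coeff (fin 1)))
        (π (fin 0) zero ∘ row (fin 0) (next 0 (coeff (fin 1))))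
      ≈⟨ ∂-congˡ f (trans (π-row₀ _) (coeff-deg (fin 1) zero))
           (trans (π-row₀ _) (trans (·-congʳ (frac-self 1))
             (trans (·-identityˡ _) (coeff-deg (fin 1) (suc zero))))) ⟩
    ∂ f π₀ π₁
      ≈⟨ trans (∘-congˡ (sym (pair-unique (identityʳ _) (identityʳ _)))) (identityʳ _) ⟩
    D f ∎
    where
    open Fractions inverses using (frac-self)

-- The doubling array

module Doubling
  {c ℓr o m ℓ : Level} {R : CommutativeSemiring c ℓr} (A : LeftAdditiveCategory R o m ℓ) where
  open CommutativeSemiring R using (semiring; rawSemiring; 1#; distribʳ; *-identityˡ)
    renaming ( Carrier to K; sym to symᴷ; trans to transᴷ; reflexive to reflexiveᴷ; _≈_ to _≈ᴷ_
             ; _+_ to _⊕_; _*_ to _⊗_; +-cong to ⊕-cong; +-identityʳ to ⊕-identityʳ)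
  open RawSemiringDefinitions rawSemiring using (_^_)
  open SemiringMult semiring using (×-homo-+)
  open LeftAdditiveCategory A
  open LeftAdditive A

  -- 2^(m+2) − 3
  excess : ℕ → ℕ
  excess zero    = 1
  excess (suc m) = 3 ℕ.+ (excess m ℕ.+ excess m)

  two : K
  two = 1# ⊕ 1#

  double : ∀ r → two ⊗ r ≈ᴷ r ⊕ r
  double r = transᴷ (distribʳ _ _ _) (⊕-cong (*-identityˡ r) (*-identityˡ r))

  -- The form 3 + e lets two units be split off and leaves a successor, which is invertible in R.
  two-^ : ∀ m → two ^ (2 ℕ.+ m) ≈ᴷ nat (3 ℕ.+ excess m)
  two-^ zero    = transᴷ (double _) (transᴷ
    (⊕-cong (double 1#) (double 1#)) (transᴷ (⊕-cong one+one one+one) (symᴷ (×-homo-+ 1# 2 2))))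
    where
    one+one : 1# ⊕ 1# ≈ᴷ nat 2
    one+one = ⊕-cong (reflexiveᴷ ≡.refl) (symᴷ (⊕-identityʳ 1#))
  two-^ (suc m) = transᴷ (double _) (transᴷ (⊕-cong (two-^ m) (two-^ m)) (transᴷ
    (symᴷ (×-homo-+ 1# (3 ℕ.+ excess m) (3 ℕ.+ excess m)))
    (reflexiveᴷ (≡.cong nat (ℕ-double (excess m))))))
    where
    ℕ-double : ∀ e → (3 ℕ.+ e) ℕ.+ (3 ℕ.+ e) ≡ 6 ℕ.+ (e ℕ.+ e)
    ℕ-double = solve-∀

  two-^-· : ∀ m {X Y} (f : X ⇒ Y) →
            (two ^ (2 ℕ.+ m)) · f ≈ f + (f + nat (suc (excess m)) · f)
  two-^-· m f = trans (·-congʳ (two-^ m))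
    (trans (·-distribʳ _ _ _)
      (+-cong (·-identityˡ f) (trans (·-distribʳ _ _ _) (+-congʳ (·-identityˡ f)))))

  module _ {W X : Obj} (y : ℕ → W ⇒ X) where
    -- The border already contributes 2 y_k to the antidiagonal of degree k ≥ 1. The missing 2^k - 2
    -- copies are put at inner index 1, where `conv` exposes them right after its first term.
    doubling : ℕ → ℕ → W ⇒ X
    doubling zero    a             = y a
    doubling (suc b) zero          = y (suc b)
    doubling (suc b) (suc zero)    = nat (suc (excess b)) · y (suc (suc b))
    doubling (suc b) (suc (suc a)) = 0⇒

    doubling-column : ∀ b → doubling b 0 ≈ y b
    doubling-column zero    = refl
    doubling-column (suc b) = refl

    θ-doubling : ∀ a → conv a (λ i j → doubling j i) ≈ (two ^ a) · y a
    θ-doubling zero          = sym (·-identityˡ _)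
    θ-doubling (suc zero)    = sym (trans (·-congʳ (double 1#))
      (trans (·-distribʳ _ _ _) (+-cong (·-identityˡ _) (·-identityˡ _))))
    θ-doubling (suc (suc m)) = begin
      y (2 ℕ.+ m) + (nat (suc (excess m)) · y (2 ℕ.+ m) + conv m (λ i j → doubling j (2 ℕ.+ i)))
        -- At inner indices from 2 on, only the outer row 0 is nonzero.
        ≈⟨ +-congˡ (+-congˡ (conv-firstColumn m _ λ i j → refl)) ⟩
      y (2 ℕ.+ m) + (nat (suc (excess m)) · y (2 ℕ.+ m) + y (2 ℕ.+ m))
        ≈⟨ +-congˡ (+-comm _ _) ⟩
      y (2 ℕ.+ m) + (y (2 ℕ.+ m) + nat (suc (excess m)) · y (2 ℕ.+ m))
        ≈⟨ two-^-· m _ ⟨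
      (two ^ (2 ℕ.+ m)) · y (2 ℕ.+ m) ∎

-- Coefficients of a Taylor expansion

module FromTaylor
  {c ℓr o m ℓ : Level} {R : CommutativeSemiring c ℓr}
  {C : CartesianLeftAdditiveCategory R o m ℓ}
  {n : Order C} (taylor : Differential.TaylorExpansion C n) where
  open CommutativeSemiring R using (rawSemiring; 0#; 1#; *-identityʳ) renaming (sym to symᴷ)
  open RawSemiringDefinitions rawSemiring using (_^_)
  open CartesianLeftAdditiveCategory C
  open LeftAdditive leftAdditiveCategory
  open Differential C hiding (t; T)
  open Powers C
  open Doubling leftAdditiveCategory
  open TaylorExpansion taylor hiding (identity)

  u : ∀ k {X Y} → X ⇒ Y → S n X ⇒ Y
  u k f = coeff n k ∘ U f

  u-cong : ∀ k {X Y} {f g : X ⇒ Y} → f ≈ g → u k f ≈ u k g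
  u-cong k f≈g = ∘-congˡ (F-cong f≈g)

  -- The counterpart of `Linear` on the side of expansions.
  Preserved : ∀ {X Y} → X ⇒ Y → Set ℓ
  Preserved p = U p ≈ S-map n p

  S-map-cong : ∀ {X Y} {f g : X ⇒ Y} → f ≈ g → S-map n f ≈ S-map n g
  S-map-cong f≈g = tuple-cong n λ k → ∘-congʳ f≈g

  preserved-cong : ∀ {X Y} {p q : X ⇒ Y} → p ≈ q → Preserved p → Preserved q
  preserved-cong p≈q p-preserved = trans (F-cong (sym p≈q)) (trans p-preserved (S-map-cong p≈q))

  preserved-coeff : ∀ {X} a → a ≤ω n → Preserved (coeff n {X} a)
  preserved-coeff a a≤n = preserved-cong (sym (coeff-π n a≤n)) (U-projection (isProjection n _))

  u-preserved-∘ : ∀ {k} → k ≤ω n → ∀ {X Y Z} {p : Y ⇒ Z} → Preserved p → (f : X ⇒ Y) →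
                  u k (p ∘ f) ≈ p ∘ u k f
  u-preserved-∘ {k} k≤n {p = p} p-preserved f = begin
    coeff n k ∘ U (p ∘ f)           ≈⟨ ∘-congˡ (trans (compose p f) (∘-congʳ p-preserved)) ⟩
    coeff n k ∘ (S-map n p ∘ U f)   ≈⟨ assoc _ _ _ ⟨
    (coeff n k ∘ S-map n p) ∘ U f   ≈⟨ ∘-congʳ (coeff-S-map n k≤n p) ⟩
    (p ∘ coeff n k) ∘ U f           ≈⟨ assoc _ _ _ ⟩
    p ∘ u k f                       ∎

  u-preserved : ∀ {k} → k ≤ω n → ∀ {X Y} {p : X ⇒ Y} → Preserved p → u k p ≈ p ∘ coeff n k
  u-preserved k≤n p-preserved = trans (∘-congˡ p-preserved) (coeff-S-map n k≤n _)

  u-∘-preserved-row : ∀ k {W X Y Z} (g : Y ⇒ Z) {p : X ⇒ Y} → Preserved p → (x : ℕ → W ⇒ X) →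
                      u k (g ∘ p) ∘ row n x ≈ u k g ∘ row n (λ a → p ∘ x a)
  u-∘-preserved-row k g {p} p-preserved x = begin
    (coeff n k ∘ U (g ∘ p)) ∘ row n x
      ≈⟨ ∘-congʳ (trans (∘-congˡ (trans (compose g p) (∘-congˡ p-preserved))) (sym (assoc _ _ _))) ⟩
    (u k g ∘ S-map n p) ∘ row n x
      ≈⟨ assoc _ _ _ ⟩
    u k g ∘ (S-map n p ∘ row n x)
      ≈⟨ ∘-congˡ (trans (∘-congʳ (S-map≈row n p)) (trans (row-∘ n _ _) (row-cong n λ a a≤n →
           trans (assoc _ _ _) (∘-congˡ (coeff-row n a≤n x))))) ⟩
    u k g ∘ row n (λ a → p ∘ x a) ∎

  preserved-π₀ : ∀ {X} → Preserved (π₀ {X})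
  preserved-π₀ = U-projection (finite _ zero)

  preserved-π₁ : ∀ {X} → Preserved (π₁ {X})
  preserved-π₁ = U-projection (finite _ (suc zero))

  -- A sum of morphisms is their pairing followed by π₀ + π₁, and U acts coefficientwise on the
  -- latter.
  u-+ : ∀ {k} → k ≤ω n → ∀ {X Y} (f g : X ⇒ Y) → u k (f + g) ≈ u k f + u k g
  u-+ {k} k≤n f g = begin
    u k (f + g)
      ≈⟨ u-cong k (trans (+-∘ π₀ π₁ _) (+-cong (π₀-pair f g) (π₁-pair f g))) ⟨
    u k ((π₀ + π₁) ∘ ⟨ f , g ⟩)
      ≈⟨ u-preserved-∘ k≤n U-+ _ ⟩
    (π₀ + π₁) ∘ u k ⟨ f , g ⟩
      ≈⟨ +-∘ π₀ π₁ _ ⟩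
    π₀ ∘ u k ⟨ f , g ⟩ + π₁ ∘ u k ⟨ f , g ⟩
      ≈⟨ +-cong (trans (sym (u-preserved-∘ k≤n preserved-π₀ _)) (u-cong k (π₀-pair f g)))
                (trans (sym (u-preserved-∘ k≤n preserved-π₁ _)) (u-cong k (π₁-pair f g))) ⟩
    u k f + u k g ∎

  u-· : ∀ {k} → k ≤ω n → ∀ r {X Y} (f : X ⇒ Y) → u k (r · f) ≈ r · u k f
  u-· {k} k≤n r f = begin
    u k (r · f)          ≈⟨ u-cong k (trans (·-∘ r id f) (·-congˡ (identityˡ f))) ⟨
    u k ((r · id) ∘ f)   ≈⟨ u-preserved-∘ k≤n (U-· r) f ⟩
    (r · id) ∘ u k f     ≈⟨ trans (·-∘ r id _) (·-congˡ (identityˡ _)) ⟩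
    r · u k f            ∎

  u-0 : ∀ {k} → k ≤ω n → ∀ {X Y} → u k (0⇒ {X} {Y}) ≈ 0⇒
  u-0 {k} k≤n = begin
    u k 0⇒          ≈⟨ u-cong k (·-zeroˡ 0⇒) ⟨
    u k (0# · 0⇒)   ≈⟨ u-· k≤n 0# 0⇒ ⟩
    0# · u k 0⇒     ≈⟨ ·-zeroˡ _ ⟩
    0⇒              ∎

  preserved-0 : ∀ {X Y} → Preserved (0⇒ {X} {Y})
  preserved-0 = coeff-ext n λ k k≤n →
    trans (u-0 k≤n) (sym (trans (coeff-S-map n k≤n 0⇒) (0-∘ _)))

  preserved-row : ∀ {X Y} {x : ℕ → X ⇒ Y} → (∀ a → a ≤ω n → Preserved (x a)) → Preserved (row n x)
  preserved-row {x = x} x-preserved = coeff-ext n λ b b≤n → coeff-ext n λ a a≤n → begin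
    coeff n a ∘ u b (row n x)
      ≈⟨ u-preserved-∘ b≤n (preserved-coeff a a≤n) _ ⟨
    u b (coeff n a ∘ row n x)
      ≈⟨ u-cong b (coeff-row n a≤n x) ⟩
    u b (x a)
      ≈⟨ u-preserved b≤n (x-preserved a a≤n) ⟩
    x a ∘ coeff n b
      ≈⟨ trans (sym (assoc _ _ _)) (∘-congʳ (coeff-row n a≤n x)) ⟨
    coeff n a ∘ (row n x ∘ coeff n b)
      ≈⟨ ∘-congˡ (coeff-S-map n b≤n _) ⟨
    coeff n a ∘ (coeff n b ∘ S-map n (row n x)) ∎

  u-zero : ∀ {X Y} (f : X ⇒ Y) → u 0 f ≈ f ∘ coeff n 0
  u-zero f = trans (∘-congʳ (sym (π-ix₀ n))) (trans (π₀-natural f) (∘-congˡ (π-ix₀ n)))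

  u-zero-row : ∀ {W X Y} (f : X ⇒ Y) (x : ℕ → W ⇒ X) → u 0 f ∘ row n x ≈ f ∘ x 0
  u-zero-row f x = trans (∘-congʳ (u-zero f))
    (trans (assoc _ _ _) (∘-congˡ (coeff-row n (0≤ω n) x)))

  u-constant : ∀ {k} → k ≤ω n → ∀ {W X Y} (f : X ⇒ Y) (x : W ⇒ X) →
               u k f ∘ row n (λ a → x when (a ℕ.≟ 0)) ≈ f ∘ x when (k ℕ.≟ 0)
  u-constant {k} k≤n f x = begin
    (coeff n k ∘ U f) ∘ row n (λ a → x when (a ℕ.≟ 0))
      ≈⟨ trans (∘-congˡ (sym (ι-∘ n x))) (assoc _ _ _) ⟩
    coeff n k ∘ (U f ∘ (ι n ∘ x))
      ≈⟨ ∘-congˡ (trans (sym (assoc _ _ _)) (trans (∘-congʳ (sym (ι-natural f))) (assoc _ _ _))) ⟩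
    coeff n k ∘ (ι n ∘ (f ∘ x))
      ≈⟨ trans (∘-congˡ (ι-∘ n (f ∘ x))) (coeff-row n k≤n _) ⟩
    f ∘ x when (k ℕ.≟ 0) ∎

  u-scale : ∀ {k} → k ≤ω n → ∀ r {W X Y} (f : X ⇒ Y) (x : ℕ → W ⇒ X) →
            u k f ∘ row n (λ a → (r ^ a) · x a) ≈ (r ^ k) · (u k f ∘ row n x)
  u-scale {k} k≤n r f x = begin
    (coeff n k ∘ U f) ∘ row n (λ a → (r ^ a) · x a)
      ≈⟨ trans (∘-congˡ (sym (scale-∘ n r x))) (assoc _ _ _) ⟩
    coeff n k ∘ (U f ∘ (scale n r ∘ row n x))
      ≈⟨ ∘-congˡ (trans (sym (assoc _ _ _)) (trans (∘-congʳ (sym (scale-natural r f))) (assoc _ _ _))) ⟩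
    coeff n k ∘ (scale n r ∘ (U f ∘ row n x))
      ≈⟨ ∘-congˡ (trans (∘-congˡ (sym (row-coeff n _))) (scale-∘ n r _)) ⟩
    coeff n k ∘ row n (λ a → (r ^ a) · (coeff n a ∘ (U f ∘ row n x)))
      ≈⟨ coeff-row n k≤n _ ⟩
    (r ^ k) · (coeff n k ∘ (U f ∘ row n x))
      ≈⟨ ·-congˡ (assoc _ _ _) ⟨
    (r ^ k) · (u k f ∘ row n x) ∎

  UU-row₂ : ∀ {W X Y} (f : X ⇒ Y) (x : ℕ → ℕ → W ⇒ X) →
            U (U f) ∘ row₂ n x ≈ row₂ n (λ j i → u j (u i f) ∘ row₂ n x)
  UU-row₂ f x = row-unique n λ j j≤n → row-unique n λ i i≤n → begin
    coeff n i ∘ (coeff n j ∘ (U (U f) ∘ row₂ n x))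
      ≈⟨ trans (∘-congˡ (sym (assoc _ _ _))) (sym (assoc _ _ _)) ⟩
    (coeff n i ∘ u j (U f)) ∘ row₂ n x
      ≈⟨ ∘-congʳ (u-preserved-∘ j≤n (preserved-coeff i i≤n) (U f)) ⟨
    u j (u i f) ∘ row₂ n x ∎

  u-θ : ∀ {k} → k ≤ω n → ∀ {W X Y} (f : X ⇒ Y) (x : ℕ → ℕ → W ⇒ X) →
        u k f ∘ row n (λ a → conv a (λ i j → x j i)) ≈ conv k (λ i j → u j (u i f) ∘ row₂ n x)
  u-θ {k} k≤n f x = begin
    (coeff n k ∘ U f) ∘ row n (λ a → conv a (λ i j → x j i))
      ≈⟨ trans (∘-congˡ (sym (θ-∘ n x))) (assoc _ _ _) ⟩
    coeff n k ∘ (U f ∘ (θ n ∘ row₂ n x))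
      ≈⟨ ∘-congˡ (trans (sym (assoc _ _ _)) (trans (∘-congʳ (sym (θ-natural f))) (assoc _ _ _))) ⟩
    coeff n k ∘ (θ n ∘ (U (U f) ∘ row₂ n x))
      ≈⟨ ∘-congˡ (trans (∘-congˡ (UU-row₂ f x)) (θ-∘ n _)) ⟩
    coeff n k ∘ row n (λ k → conv k (λ i j → u j (u i f) ∘ row₂ n x))
      ≈⟨ coeff-row n k≤n _ ⟩
    conv k (λ i j → u j (u i f) ∘ row₂ n x) ∎

  coeff-row₂ : ∀ {i j W X} → j ≤ω n → i ≤ω n → (x : ℕ → ℕ → W ⇒ X) →
               coeff n i ∘ (coeff n j ∘ row₂ n x) ≈ x j i
  coeff-row₂ j≤n i≤n x = trans (∘-congˡ (coeff-row n j≤n _)) (coeff-row n i≤n (x _))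

  uu-row₂ : ∀ {i j W X Y} → j ≤ω n → i ≤ω n → (f : X ⇒ Y) (h : W ⇒ S n (S n X)) →
            u j (u i f) ∘ h ≈ coeff n i ∘ (coeff n j ∘ (U (U f) ∘ h))
  uu-row₂ j≤n i≤n f h = trans (∘-congʳ (u-preserved-∘ j≤n (preserved-coeff _ i≤n) (U f)))
    (trans (assoc _ _ _) (∘-congˡ (assoc _ _ _)))

  u-exchange : ∀ {i j} → j ≤ω n → i ≤ω n → ∀ {W X Y} (f : X ⇒ Y) (x : ℕ → ℕ → W ⇒ X) →
               u j (u i f) ∘ row₂ n x ≈ u i (u j f) ∘ row₂ n (λ a b → x b a)
  u-exchange {i} {j} j≤n i≤n f x = begin
    u j (u i f) ∘ row₂ n x
      ≈⟨ coeff-row₂ i≤n j≤n (λ i j → u j (u i f) ∘ row₂ n x) ⟨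
    coeff n j ∘ (coeff n i ∘ row₂ n (λ i j → u j (u i f) ∘ row₂ n x))
      ≈⟨ ∘-congˡ (∘-congˡ (trans (∘-congˡ (UU-row₂ f x)) (exchange-∘ n _))) ⟨
    coeff n j ∘ (coeff n i ∘ (exchange n ∘ (U (U f) ∘ row₂ n x)))
      ≈⟨ ∘-congˡ (∘-congˡ (trans (sym (assoc _ _ _))
           (trans (∘-congʳ (exchange-natural f)) (assoc _ _ _)))) ⟩
    coeff n j ∘ (coeff n i ∘ (U (U f) ∘ (exchange n ∘ row₂ n x)))
      ≈⟨ ∘-congˡ (∘-congˡ (∘-congˡ (exchange-∘ n x))) ⟩
    coeff n j ∘ (coeff n i ∘ (U (U f) ∘ row₂ n (λ a b → x b a)))
      ≈⟨ uu-row₂ i≤n j≤n f _ ⟨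
    u i (u j f) ∘ row₂ n (λ a b → x b a) ∎

  u-lift : ∀ {i j} → j ≤ω n → i ≤ω n → ∀ {W X Y} (f : X ⇒ Y) (x : ℕ → W ⇒ X) →
           u j (u i f) ∘ row₂ n (λ b a → x a when (a ℕ.≟ b)) ≈ u i f ∘ row n x when (i ℕ.≟ j)
  u-lift {i} {j} j≤n i≤n f x = begin
    u j (u i f) ∘ row₂ n (λ b a → x a when (a ℕ.≟ b))
      ≈⟨ uu-row₂ j≤n i≤n f _ ⟩
    coeff n i ∘ (coeff n j ∘ (U (U f) ∘ row₂ n (λ b a → x a when (a ℕ.≟ b))))
      ≈⟨ ∘-congˡ (∘-congˡ (∘-congˡ (lift-∘ n x))) ⟨
    coeff n i ∘ (coeff n j ∘ (U (U f) ∘ (lift n ∘ row n x)))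
      ≈⟨ ∘-congˡ (∘-congˡ (trans (sym (assoc _ _ _))
           (trans (∘-congʳ (sym (lift-natural f))) (assoc _ _ _)))) ⟩
    coeff n i ∘ (coeff n j ∘ (lift n ∘ (U f ∘ row n x)))
      ≈⟨ ∘-congˡ (∘-congˡ (trans (∘-congˡ (sym (row-coeff n _))) (lift-∘ n _))) ⟩
    coeff n i ∘ (coeff n j ∘ row₂ n (λ b a → (coeff n a ∘ (U f ∘ row n x)) when (a ℕ.≟ b)))
      ≈⟨ coeff-row₂ j≤n i≤n _ ⟩
    (coeff n i ∘ (U f ∘ row n x)) when (i ℕ.≟ j)
      ≈⟨ when-cong (i ℕ.≟ j) (assoc _ _ _) ⟨
    u i f ∘ row n x when (i ℕ.≟ j) ∎

  -- A term of `u-θ` with inner order 0 reads the first column only; the one with outer order 0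
  -- reads the first row, by `u-zero-row`.
  uu-zero-row₂ : ∀ j {W X Y} (f : X ⇒ Y) (x : ℕ → ℕ → W ⇒ X) →
                 u j (u 0 f) ∘ row₂ n x ≈ u j f ∘ row n (λ b → x b 0)
  uu-zero-row₂ j f x = trans (∘-congʳ (u-cong j (u-zero f)))
    (trans (u-∘-preserved-row j f (preserved-coeff 0 (0≤ω n)) _)
           (∘-congˡ (row-cong n λ b _ → coeff-row n (0≤ω n) (x b))))

  -- The first coefficient as a derivative

  module First (1≤n : 1 ≤ω n) where
    u-θ₁ : ∀ {W X Y} (f : X ⇒ Y) (x : ℕ → ℕ → W ⇒ X) →
           u 1 f ∘ row n (λ a → conv a (λ i j → x j i)) ≈
           u 1 f ∘ row n (λ b → x b 0) + u 1 f ∘ row n (x 0)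
    u-θ₁ f x = trans (u-θ 1≤n f x) (+-cong (uu-zero-row₂ 1 f x) (u-zero-row (u 1 f) _))

    pad : ∀ {W X} → W ⇒ X → W ⇒ X → ℕ → W ⇒ X
    pad x v zero          = x
    pad x v (suc zero)    = v
    pad x v (suc (suc _)) = 0⇒

    pad-0 : ∀ {W X} (x : W ⇒ X) a → pad x 0⇒ a ≈ x when (a ℕ.≟ 0)
    pad-0 x zero          = refl
    pad-0 x (suc zero)    = refl
    pad-0 x (suc (suc a)) = refl

    u₁-pad-0 : ∀ {W X Y} (f : X ⇒ Y) (x : W ⇒ X) → u 1 f ∘ row n (pad x 0⇒) ≈ 0⇒
    u₁-pad-0 f x = trans (∘-congˡ (row-cong n λ a _ → pad-0 x a)) (u-constant 1≤n f x)

    -- u-θ₁ sees only the entries with an index 0, so the coefficients of order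
    -- a ≥ 2 can be hidden at (1, a − 1).
    u₁-determined : ∀ {W X Y} (f : X ⇒ Y) (x : ℕ → W ⇒ X) →
                    u 1 f ∘ row n x ≈ u 1 f ∘ row n (pad (x 0) (x 1))
    u₁-determined {W} {X} f x = begin
      u 1 f ∘ row n x
        ≈⟨ ∘-congˡ (row-cong n λ a _ → total a) ⟨
      u 1 f ∘ row n (λ a → conv a y)
        ≈⟨ u-θ₁ f (λ b a → y a b) ⟩
      u 1 f ∘ row n (y 0) + u 1 f ∘ row n (λ a → y a 0)
        ≈⟨ +-congˡ (∘-congˡ (row-cong n λ a _ → top a)) ⟩
      u 1 f ∘ row n (pad (x 0) (x 1)) + u 1 f ∘ row n (pad (x 0) 0⇒)
        ≈⟨ trans (+-congˡ (u₁-pad-0 f (x 0))) (+-identityʳ _) ⟩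
      u 1 f ∘ row n (pad (x 0) (x 1)) ∎
      where
      -- the first argument is the inner index
      y : ℕ → ℕ → W ⇒ X
      y zero          b       = pad (x 0) (x 1) b
      y (suc zero)    zero    = 0⇒
      y (suc zero)    (suc b) = x (suc (suc b))
      y (suc (suc _)) b       = 0⇒

      total : ∀ a → conv a y ≈ x a
      total zero          = refl
      total (suc zero)    = +-identityʳ _
      total (suc (suc a)) = trans (+-identityˡ _)
        (trans (+-congˡ (conv-0 a λ i j → refl)) (+-identityʳ _))

      top : ∀ a → y a 0 ≈ pad (x 0) 0⇒ a
      top zero          = refl
      top (suc zero)    = refl
      top (suc (suc a)) = refl

    -- An array with x in the corner, v and w next to it and 0 elsewhere has the antidiagonal sums
    -- x, v + w, 0, and so on, while its two border lines are the padded pairs (x, v) and (x, w).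
    u₁-pad-+ : ∀ {W X Y} (f : X ⇒ Y) (x v w : W ⇒ X) →
               u 1 f ∘ row n (pad x (v + w)) ≈ u 1 f ∘ row n (pad x v) + u 1 f ∘ row n (pad x w)
    u₁-pad-+ {W} {X} f x v w = begin
      u 1 f ∘ row n (pad x (v + w))
        ≈⟨ ∘-congˡ (row-cong n λ a _ → total a) ⟨
      u 1 f ∘ row n (λ a → conv a y)
        ≈⟨ u-θ₁ f (λ b a → y a b) ⟩
      u 1 f ∘ row n (y 0) + u 1 f ∘ row n (λ a → y a 0)
        ≈⟨ +-congˡ (∘-congˡ (row-cong n λ a _ → top a)) ⟩
      u 1 f ∘ row n (pad x v) + u 1 f ∘ row n (pad x w) ∎
      where
      y : ℕ → ℕ → W ⇒ X
      y zero          b       = pad x v b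
      y (suc zero)    zero    = w
      y (suc zero)    (suc _) = 0⇒
      y (suc (suc _)) b       = 0⇒

      total : ∀ a → conv a y ≈ pad x (v + w) a
      total zero          = refl
      total (suc zero)    = refl
      total (suc (suc a)) = trans (+-identityˡ _)
        (trans (+-identityˡ _) (conv-0 a λ i j → refl))

      top : ∀ a → y a 0 ≈ pad x w a
      top zero          = refl
      top (suc zero)    = refl
      top (suc (suc a)) = refl

    D : ∀ {X Y} → X ⇒ Y → Sq X ⇒ Y
    D = u₁ 1≤n taylor

    D≈u : ∀ {X Y} (f : X ⇒ Y) → D f ≈ u 1 f ∘ row n (coeff (fin 1))
    D≈u f = trans (∘-cong (sym (coeff-embed n 1≤n (suc zero))) (∘-congˡ (z≈row 1 n))) (sym (assoc _ _ _))

    coeff-pair : ∀ {W X} (x v : W ⇒ X) a → coeff (fin 1) a ∘ ⟨ x , v ⟩ ≈ pad x v a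
    coeff-pair x v zero          = trans (∘-congʳ (coeff-deg (fin 1) zero)) (π₀-pair x v)
    coeff-pair x v (suc zero)    = trans (∘-congʳ (coeff-deg (fin 1) (suc zero))) (π₁-pair x v)
    coeff-pair x v (suc (suc a)) = go (suc (suc a) ℕ.<? 2)
      where
      go : (a<? : Dec (suc (suc a) ℕ.< 2)) → z-component a<? ∘ ⟨ x , v ⟩ ≈ 0⇒
      go (yes (s≤s (s≤s ())))
      go (no _) = 0-∘ _

    D-pair : ∀ {W X Y} (f : X ⇒ Y) (x v : W ⇒ X) → D f ∘ ⟨ x , v ⟩ ≈ u 1 f ∘ row n (pad x v)
    D-pair f x v = trans (∘-congʳ (D≈u f)) (trans (assoc _ _ _)
      (∘-congˡ (trans (row-∘ n _ _) (row-cong n λ a _ → coeff-pair x v a))))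

    u≈D : ∀ {W X Y} (f : X ⇒ Y) (x : ℕ → W ⇒ X) → u 1 f ∘ row n x ≈ D f ∘ ⟨ x 0 , x 1 ⟩
    u≈D f x = trans (u₁-determined f x) (sym (D-pair f _ _))

    preserved-coeff₁ : ∀ {X} a → Preserved (coeff (fin 1) {X} a)
    preserved-coeff₁ a = go (a ℕ.<? 2)
      where
      go : ∀ {X} (a<? : Dec (a ℕ.< 2)) → Preserved (z-component {1} {a} {X} a<?)
      go (yes a<2) = U-projection (finite _ (fromℕ< a<2))
      go (no _)    = preserved-0

    -- The remaining rows are padded zero pairs, the form in which `coeff-pair` delivers them.
    quad : ∀ {W X} → W ⇒ X → W ⇒ X → W ⇒ X → W ⇒ X → ℕ → ℕ → W ⇒ X
    quad x v w y zero          = pad x v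
    quad x v w y (suc zero)    = pad w y
    quad x v w y (suc (suc _)) = pad 0⇒ 0⇒

    DD-pair : ∀ {W X Y} (f : X ⇒ Y) (x v w y : W ⇒ X) →
              D (D f) ∘ ⟨ ⟨ x , v ⟩ , ⟨ w , y ⟩ ⟩ ≈ u 1 (u 1 f) ∘ row₂ n (quad x v w y)
    DD-pair f x v w y = begin
      D (D f) ∘ ⟨ ⟨ x , v ⟩ , ⟨ w , y ⟩ ⟩
        ≈⟨ D-pair (D f) _ _ ⟩
      u 1 (D f) ∘ row n (pad ⟨ x , v ⟩ ⟨ w , y ⟩)
        ≈⟨ ∘-congʳ (u-cong 1 (D≈u f)) ⟩
      u 1 (u 1 f ∘ row n (coeff (fin 1))) ∘ row n (pad ⟨ x , v ⟩ ⟨ w , y ⟩)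
        ≈⟨ u-∘-preserved-row 1 (u 1 f) (preserved-row λ a _ → preserved-coeff₁ a) _ ⟩
      u 1 (u 1 f) ∘ row n (λ b → row n (coeff (fin 1)) ∘ pad ⟨ x , v ⟩ ⟨ w , y ⟩ b)
        ≈⟨ ∘-congˡ (row-cong n λ b _ → trans (row-∘ n _ _) (row-cong n λ a _ → entry b a)) ⟩
      u 1 (u 1 f) ∘ row₂ n (quad x v w y) ∎
      where
      entry : ∀ b a → coeff (fin 1) a ∘ pad ⟨ x , v ⟩ ⟨ w , y ⟩ b ≈ quad x v w y b a
      entry zero          a = coeff-pair x v a
      entry (suc zero)    a = coeff-pair w y a
      entry (suc (suc b)) a = trans (∘-congˡ (sym pair-0)) (coeff-pair 0⇒ 0⇒ a)

    quad-transpose : ∀ {W X} (x v w y : W ⇒ X) b a → quad x v w y a b ≈ quad x w v y b a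
    quad-transpose x v w y zero          zero          = refl
    quad-transpose x v w y zero          (suc zero)    = refl
    quad-transpose x v w y zero          (suc (suc a)) = refl
    quad-transpose x v w y (suc zero)    zero          = refl
    quad-transpose x v w y (suc zero)    (suc zero)    = refl
    quad-transpose x v w y (suc zero)    (suc (suc a)) = refl
    quad-transpose x v w y (suc (suc b)) zero          = refl
    quad-transpose x v w y (suc (suc b)) (suc zero)    = refl
    quad-transpose x v w y (suc (suc b)) (suc (suc a)) = refl

    -- The arguments in `D-lift` form exactly the array that `lift` makes from the padded pair.
    quad-diagonal : ∀ {W X} (x v : W ⇒ X) b a → quad x 0⇒ 0⇒ v b a ≈ pad x v a when (a ℕ.≟ b)
    quad-diagonal x v zero          zero          = refl
    quad-diagonal x v zero          (suc zero)    = refl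
    quad-diagonal x v zero          (suc (suc a)) = refl
    quad-diagonal x v (suc zero)    zero          = refl
    quad-diagonal x v (suc zero)    (suc zero)    = refl
    quad-diagonal x v (suc zero)    (suc (suc a)) = refl
    quad-diagonal x v (suc (suc b)) zero          = refl
    quad-diagonal x v (suc (suc b)) (suc zero)    = refl
    quad-diagonal x v (suc (suc b)) (suc (suc a)) = sym (when-0 (a ℕ.≟ b))

    D-preserved : ∀ {X Y} {p : X ⇒ Y} → Preserved p → D p ≈ p ∘ π₁
    D-preserved {p = p} p-preserved = begin
      D p                                        ≈⟨ D≈u p ⟩
      u 1 p ∘ row n (coeff (fin 1))              ≈⟨ ∘-congʳ (u-preserved 1≤n p-preserved) ⟩
      (p ∘ coeff n 1) ∘ row n (coeff (fin 1))    ≈⟨ assoc _ _ _ ⟩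
      p ∘ (coeff n 1 ∘ row n (coeff (fin 1)))    ≈⟨ ∘-congˡ (coeff-row n 1≤n _) ⟩
      p ∘ coeff (fin 1) 1                        ≈⟨ ∘-congˡ (coeff-deg (fin 1) (suc zero)) ⟩
      p ∘ π₁                                     ∎

    derivative : Derivative n
    derivative = record
      { D            = D
      ; D-projection = λ p → D-preserved (U-projection p)
      ; D-additive   = mkAdditive
          (λ f≈g → trans (D≈u _) (trans (∘-congʳ (u-cong 1 f≈g)) (sym (D≈u _))))
          (λ f g → trans (D≈u _) (trans (∘-congʳ (u-+ 1≤n f g)) (trans (+-∘ _ _ _)
             (sym (+-cong (D≈u f) (D≈u g))))))
          (trans (D≈u _) (trans (∘-congʳ (u-0 1≤n)) (0-∘ _)))
          (λ r f → trans (D≈u _) (trans (∘-congʳ (u-· 1≤n r f)) (trans (·-∘ _ _ _)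
             (sym (·-congˡ (D≈u f))))))
      ; D-id         = trans (D-preserved preserved-id) (identityˡ _)
      ; D-∘          = λ g f → begin
          D (g ∘ f)
            ≈⟨ trans (D≈u _) (∘-congʳ (trans (∘-congˡ (compose g f)) (sym (assoc _ _ _)))) ⟩
          (u 1 g ∘ U f) ∘ row n (coeff (fin 1))
            ≈⟨ trans (assoc _ _ _) (∘-congˡ (sym (row-coeff n _))) ⟩
          u 1 g ∘ row n (λ a → coeff n a ∘ (U f ∘ row n (coeff (fin 1))))
            -- Of all coefficients of `U f`, only those of degree 0 and 1 matter to `u 1 g`.
            ≈⟨ u≈D g _ ⟩
          D g ∘ ⟨ coeff n 0 ∘ (U f ∘ row n (coeff (fin 1))) , coeff n 1 ∘ (U f ∘ row n (coeff (fin 1))) ⟩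
            ≈⟨ ∘-congˡ (pair-cong
                 (trans (sym (assoc _ _ _)) (trans (u-zero-row f _) (∘-congˡ (coeff-deg (fin 1) zero))))
                 (trans (sym (assoc _ _ _)) (sym (D≈u f)))) ⟩
          D g ∘ ⟨ f ∘ π₀ , D f ⟩ ∎
      ; D-linear     = λ f x → mkAdditive
          (λ v≈w → ∘-congˡ (pair-cong refl v≈w))
          (λ v w → trans (D-pair f _ _) (trans (u₁-pad-+ f x v w)
             (sym (+-cong (D-pair f x v) (D-pair f x w)))))
          (trans (D-pair f _ _) (u₁-pad-0 f x))
          (λ r v → begin
             D f ∘ ⟨ x , r · v ⟩
               ≈⟨ D-pair f _ _ ⟩
             u 1 f ∘ row n (pad x (r · v))
               -- Scaling by r fixes x, multiplies v by r, and has no effect on the zeros above, so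
               -- homogeneity is an instance of naturality of `scale`.
               ≈⟨ ∘-congˡ (row-cong n λ
                    { zero          _ → sym (·-identityˡ x)
                    ; (suc zero)    _ → ·-congʳ (symᴷ (*-identityʳ r))
                    ; (suc (suc a)) _ → sym (·-zeroʳ _) }) ⟩
             u 1 f ∘ row n (λ a → (r ^ a) · pad x v a)
               ≈⟨ u-scale 1≤n r f (pad x v) ⟩
             (r ^ 1) · (u 1 f ∘ row n (pad x v))
               ≈⟨ ·-cong (*-identityʳ r) (sym (D-pair f x v)) ⟩
             r · (D f ∘ ⟨ x , v ⟩) ∎)
      ; D-lift       = λ f x v → begin
          D (D f) ∘ ⟨ ⟨ x , 0⇒ ⟩ , ⟨ 0⇒ , v ⟩ ⟩
            ≈⟨ DD-pair f _ _ _ _ ⟩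
          u 1 (u 1 f) ∘ row₂ n (quad x 0⇒ 0⇒ v)
            ≈⟨ ∘-congˡ (row-cong n λ b _ → row-cong n λ a _ → quad-diagonal x v b a) ⟩
          u 1 (u 1 f) ∘ row₂ n (λ b a → pad x v a when (a ℕ.≟ b))
            ≈⟨ u-lift 1≤n 1≤n f (pad x v) ⟩
          u 1 f ∘ row n (pad x v)
            ≈⟨ D-pair f x v ⟨
          D f ∘ ⟨ x , v ⟩ ∎
      ; D-symmetric  = λ f x v w y → begin
          D (D f) ∘ ⟨ ⟨ x , v ⟩ , ⟨ w , y ⟩ ⟩
            ≈⟨ DD-pair f _ _ _ _ ⟩
          u 1 (u 1 f) ∘ row₂ n (quad x v w y)
            ≈⟨ u-exchange 1≤n 1≤n f _ ⟩
          u 1 (u 1 f) ∘ row₂ n (λ b a → quad x v w y a b)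
            ≈⟨ ∘-congˡ (row-cong n λ b _ → row-cong n λ a _ → quad-transpose x v w y b a) ⟩
          u 1 (u 1 f) ∘ row₂ n (quad x w v y)
            ≈⟨ DD-pair f _ _ _ _ ⟨
          D (D f) ∘ ⟨ ⟨ x , w ⟩ , ⟨ v , y ⟩ ⟩ ∎
      }
      where
      preserved-id : ∀ {X} → Preserved (id {X})
      preserved-id = preserved-cong (·-identityˡ id) (U-· 1#)

  -- A recursion for the higher coefficients

  u-doubling : Cancellative C → ∀ {W X} (y : ℕ → W ⇒ X) m → (2 ℕ.+ m) ≤ω n → ∀ {Y} (f : X ⇒ Y) →
    nat (suc (excess m)) · (u (2 ℕ.+ m) f ∘ row n y) ≈
    conv m (λ i j → u (suc j) (u (suc i) f) ∘ row₂ n (doubling y))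
  u-doubling cancel y m k≤n {Y} f = cancel A _ _ (cancel A _ _ (begin
    A + (A + nat (suc (excess m)) · A)
      ≈⟨ two-^-· m A ⟨
    (two ^ k) · A
      ≈⟨ u-scale k≤n two f y ⟨
    u k f ∘ row n (λ a → (two ^ a) · y a)
      ≈⟨ ∘-congˡ (row-cong n λ a _ → θ-doubling y a) ⟨
    u k f ∘ row n (λ a → conv a (λ i j → doubling y j i))
      ≈⟨ u-θ k≤n f (doubling y) ⟩
    conv k F
      -- Both ends of the antidiagonal equal A, because the first column and the first row of the
      -- array are y; each copy is cancelled against one on the other side.
      ≈⟨ +-congˡ (conv-last m (λ i → F (suc i))) ⟩
    F 0 k + (conv m (λ i j → F (suc i) (suc j)) + F k 0)
      ≈⟨ +-cong (trans (uu-zero-row₂ k f (doubling y))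
                         (∘-congˡ (row-cong n λ b _ → doubling-column y b)))
                (+-congˡ (u-zero-row (u k f) _)) ⟩
    A + (conv m (λ i j → F (suc i) (suc j)) + A)
      ≈⟨ +-congˡ (+-comm _ _) ⟩
    A + (A + conv m (λ i j → F (suc i) (suc j))) ∎))
    where
    k = 2 ℕ.+ m
    A = u k f ∘ row n y
    F : ℕ → ℕ → _ ⇒ Y
    F i j = u j (u i f) ∘ row₂ n (doubling y)

-- Uniqueness of the expansion with a given first coefficient

module Uniqueness
  {c ℓr o m ℓ : Level} {R : CommutativeSemiring c ℓr} (inverses : IntegerInverses R)
  {C : CartesianLeftAdditiveCategory R o m ℓ} (cancel : Cancellative C)
  {n : Order C} (1≤n : Differential._≤ω_ C 1 n) (T V : Differential.TaylorExpansion C n) where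
  open IntegerInverses inverses using (1/_)
  open CartesianLeftAdditiveCategory C
  open LeftAdditive leftAdditiveCategory
  open Differential C using (_≤ω_; S; u₁; TaylorExpansion)
  open Powers C
  open Doubling leftAdditiveCategory
  open Division inverses
  private
    module T = FromTaylor T
    module V = FromTaylor V

  module _ (agree : ∀ {X Y} (f : X ⇒ Y) → u₁ 1≤n T f ≈ u₁ 1≤n V f) where
    -- Strong induction, with N as the bound that decreases. The claim is made for all f at once,
    -- because the nested coefficients invoke it twice: for f in the inner place and for a
    -- coefficient of f in the outer place.
    u-agree : ∀ N {k} → k ℕ.≤ N → k ≤ω n → ∀ {X Y} (f : X ⇒ Y) → T.u k f ≈ V.u k f
    u-agree _ {zero} _ _ f = trans (T.u-zero f) (sym (V.u-zero f))
    u-agree _ {suc zero} _ _ f = begin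
      T.u 1 f                        ≈⟨ trans (∘-congˡ (row-id n)) (identityʳ _) ⟨
      T.u 1 f ∘ row n (coeff n)      ≈⟨ T.First.u≈D 1≤n f _ ⟩
      u₁ 1≤n T f ∘ _                 ≈⟨ ∘-congʳ (agree f) ⟩
      u₁ 1≤n V f ∘ _                 ≈⟨ V.First.u≈D 1≤n f _ ⟨
      V.u 1 f ∘ row n (coeff n)      ≈⟨ trans (∘-congˡ (row-id n)) (identityʳ _) ⟩
      V.u 1 f                        ∎
    u-agree (suc N) {suc (suc m)} (s≤s k≤N) k≤n {X} f = begin
      T.u (2 ℕ.+ m) f
        ≈⟨ ·-invert (excess m) _ ⟨
      1/ suc (excess m) · nat (suc (excess m)) · T.u (2 ℕ.+ m) f
        ≈⟨ ·-congˡ scaled ⟩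
      1/ suc (excess m) · nat (suc (excess m)) · V.u (2 ℕ.+ m) f
        ≈⟨ ·-invert (excess m) _ ⟩
      V.u (2 ℕ.+ m) f ∎
      where
      gen : ℕ → S n X ⇒ X
      gen = coeff n

      lower : ∀ {i j} → i ℕ.+ j ≡ m → suc i ℕ.≤ suc m
      lower e = s≤s (ℕ.m+n≤o⇒m≤o _ (ℕ.≤-reflexive e))

      lower≤ω : ∀ {i} → suc i ℕ.≤ suc m → suc i ≤ω n
      lower≤ω i≤m = ≤ω-trans n (ℕ.m≤n⇒m≤1+n i≤m) k≤n

      uu-agree : ∀ i j → i ℕ.+ j ≡ m → T.u (suc j) (T.u (suc i) f) ≈ V.u (suc j) (V.u (suc i) f)
      uu-agree i j e = trans
        (u-agree N (ℕ.≤-trans j≤m k≤N) (lower≤ω j≤m) _)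
        (V.u-cong (suc j) (u-agree N (ℕ.≤-trans i≤m k≤N) (lower≤ω i≤m) f))
        where
        i≤m = lower {i} {j} e
        j≤m = lower {j} {i} (≡.trans (ℕ.+-comm j i) e)

      scaled : nat (suc (excess m)) · T.u (2 ℕ.+ m) f ≈ nat (suc (excess m)) · V.u (2 ℕ.+ m) f
      scaled = begin
        nat (suc (excess m)) · T.u (2 ℕ.+ m) f
          ≈⟨ ·-congˡ (trans (∘-congˡ (row-id n)) (identityʳ _)) ⟨
        nat (suc (excess m)) · (T.u (2 ℕ.+ m) f ∘ row n gen)
          ≈⟨ T.u-doubling cancel gen m k≤n f ⟩
        conv m (λ i j → T.u (suc j) (T.u (suc i) f) ∘ row₂ n (doubling gen))
          ≈⟨ conv-cong m (λ i j e → ∘-congʳ (uu-agree i j e)) ⟩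
        conv m (λ i j → V.u (suc j) (V.u (suc i) f) ∘ row₂ n (doubling gen))
          ≈⟨ V.u-doubling cancel gen m k≤n f ⟨
        nat (suc (excess m)) · (V.u (2 ℕ.+ m) f ∘ row n gen)
          ≈⟨ ·-congˡ (trans (∘-congˡ (row-id n)) (identityʳ _)) ⟩
        nat (suc (excess m)) · V.u (2 ℕ.+ m) f ∎

    U-unique : ∀ {X Y} (f : X ⇒ Y) → TaylorExpansion.U T f ≈ TaylorExpansion.U V f
    U-unique f = coeff-ext n λ k k≤n → u-agree k ℕ.≤-refl k≤n f

-- The bijection

theorem6 : ∀ {c ℓr o m ℓ : Level} (R : CommutativeSemiring c ℓr) (inverses : IntegerInverses R)
    (C : CartesianLeftAdditiveCategory R o m ℓ) → Cancellative C →
    let open CartesianLeftAdditiveCategory C in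
    let open Differential C in
    (n : Order C) (1≤n : 1 ≤ω n) →
    Σ (Inverse (taylorExpansions n) (derivatives n)) λ φψ →
    (∀ (U : TaylorExpansion n) {X Y} (f : X ⇒ Y) →
    Derivative.D (Inverse.to φψ U) f ≈ u₁ 1≤n U f)
    ×
    (∀ (d : Derivative n) {X Y} (f : X ⇒ Y) →
    TaylorExpansion.U (Inverse.from φψ d) f ≈ T inverses d f)
theorem6 R inverses C cancel n 1≤n = φψ , (λ _ _ → refl) , (λ _ _ → refl)
  where
  open CartesianLeftAdditiveCategory C
  open LeftAdditive leftAdditiveCategory
  open Differential C
  open FromDerivative inverses cancel using (taylor; u₁-taylor)
  open Uniqueness inverses cancel 1≤n using (U-unique)

  φψ : Inverse (taylorExpansions n) (derivatives n)
  φψ = record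
    { to        = λ U → FromTaylor.First.derivative U 1≤n
    ; from      = taylor
    ; to-cong   = λ U≈V f → ∘-congˡ (∘-congʳ (U≈V f))
    -- The first coefficients of the two expansions are the given derivatives, so uniqueness takes
    -- the place of an induction over `t`.
    ; from-cong = λ {d} {e} d≈e → U-unique (taylor d) (taylor e) λ f →
        trans (u₁-taylor d 1≤n f) (trans (d≈e f) (sym (u₁-taylor e 1≤n f)))
    ; inverse   = (λ {d} U≈T f → trans (∘-congˡ (∘-congʳ (U≈T f))) (u₁-taylor d 1≤n f))
                , (λ {U} {d} d≈u₁ → U-unique (taylor d) U λ f →
                    trans (u₁-taylor d 1≤n f) (d≈u₁ f))
    }
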